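{- For every positive integer $n$, $$\sum_{k=0}^{n-1}\binom{n}{k}^{ -2}=\frac{(n+1)!\,(n+1)^2}{(n+\frac{3}{2})!\,4^n}\sum_{j=0}^{n-1}\frac{(3j^3+12j^2+18j+10)\,4^j\,(j+\frac32)!}{(j+1)^2\,(j+1)!\,(j+2)^3}.$$
   Context: Here factorials of non-integers are defined via the Gamma function: $x!:=\Gamma(x+1)$ for all real $x>-1$. -}

module Defs where

open import Data.Fin.Base as Fin using (Fin; toℕ)
open import Data.Fin.Properties using (toℕ<n)
open import Data.Integer.Base as ℤ using (ℤ; +_; +[1+_]; -[1+_]; +0; 0ℤ; 1ℤ)
import Data.Integer.Properties as ℤP
open import Data.Nat.Base as ℕ using (ℕ; zero; suc; _!; z≤n; s≤s)
import Data.Nat.Properties as ℕP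
import Data.Nat.Coprimality as Coprimality
open import Data.Nat.Combinatorics using (_C_; nCk≡n!/k![n-k]!; k![n∸k]!∣n!)
open import Data.Nat.Divisibility using (∣⇒≤)
open import Data.Nat.DivMod using (m≥n⇒m/n>0)
open import Data.Product.Base using (∃-syntax; _×_; _,_; proj₁; proj₂)
open import Data.Sum.Base using (_⊎_; inj₁; inj₂)
open import Algebra.Bundles using (CommutativeRing)
open import Algebra.Structures using (IsCommutativeRing)
open import Algebra.Solver.Ring.AlmostCommutativeRing using (fromCommutativeRing; _-Raw-AlmostCommutative⟶_)
import Algebra.Solver.Ring as RingSolver
import Algebra.Properties.CommutativeSemiring.Exp as Exp
open import Relation.Binary.Consequences using (dec⇒weaklyDec)
open import Relation.Nullary using (¬_; yes; no; contradiction)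
import Data.Maybe.Base as Maybe
open import Relation.Binary.PropositionalEquality using (_≡_; _≢_; refl; sym; trans; cong; cong₂; subst; subst₂)

-- Convergence of Euler's sequence is proved over an abstract ordered field:
-- with concrete rationals, conversion checking unfolds the arithmetic.
record OrderedField : Set₁ where
  infix  9 _⁻¹
  infix  8 -_
  infixl 7 _*_
  infixl 6 _+_
  infix  4 _≤_ _<_
  field
    F : Set
    _+_ _*_ : F → F → F
    -_ ∣_∣ _⁻¹ : F → F
    _≤_ _<_ : F → F → Set
    ⟦_⟧ : ℤ → F
    ½ : F
  0# : F
  0# = ⟦ 0ℤ ⟧
  1# : F
  1# = ⟦ 1ℤ ⟧
  field
    isCommutativeRing : IsCommutativeRing _≡_ _+_ _*_ -_ 0# 1#
    +-homo : ∀ m n → ⟦ m ℤ.+ n ⟧ ≡ ⟦ m ⟧ + ⟦ n ⟧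
    *-homo : ∀ m n → ⟦ m ℤ.* n ⟧ ≡ ⟦ m ⟧ * ⟦ n ⟧
    -‿homo : ∀ m → ⟦ ℤ.- m ⟧ ≡ - ⟦ m ⟧
    ½+½≡1 : ½ + ½ ≡ 1#
    ⁻¹-inverse : ∀ {q} → q ≢ 0# → q * q ⁻¹ ≡ 1#
    ≤-reflexive : ∀ {p q} → p ≡ q → p ≤ q
    ≤-trans : ∀ {p q r} → p ≤ q → q ≤ r → p ≤ r
    ≤-antisym : ∀ {p q} → p ≤ q → q ≤ p → p ≡ q
    ≤-total : ∀ p q → p ≤ q ⊎ q ≤ p
    <-irrefl : ∀ {p q} → p ≡ q → ¬ p < q
    <⇒≤ : ∀ {p q} → p < q → p ≤ q
    ≮⇒≥ : ∀ {p q} → ¬ p < q → q ≤ p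
    ≰⇒> : ∀ {p q} → ¬ p ≤ q → q < p
    <-≤-trans : ∀ {p q r} → p < q → q ≤ r → p < r
    ≤-<-trans : ∀ {p q r} → p ≤ q → q < r → p < r
    +-mono-≤ : ∀ {p q r s} → p ≤ q → r ≤ s → p + r ≤ q + s
    +-mono-<-≤ : ∀ {p q r s} → p < q → r ≤ s → p + r < q + s
    neg-antimono-≤ : ∀ {p q} → p ≤ q → - q ≤ - p
    *-monoˡ : ∀ {r p q} → 0# ≤ r → p ≤ q → r * p ≤ r * q
    *-monoʳ-< : ∀ {r p q} → 0# < r → p < q → p * r < q * r
    0<1 : 0# < 1#
    0<½ : 0# < ½
    0≤∣p∣ : ∀ p → 0# ≤ ∣ p ∣
    0≤p⇒∣p∣≡p : ∀ {p} → 0# ≤ p → ∣ p ∣ ≡ p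
    ∣-p∣≡∣p∣ : ∀ p → ∣ - p ∣ ≡ ∣ p ∣
    ∣p+q∣≤∣p∣+∣q∣ : ∀ p q → ∣ p + q ∣ ≤ ∣ p ∣ + ∣ q ∣
    ∣p*q∣≡∣p∣*∣q∣ : ∀ p q → ∣ p * q ∣ ≡ ∣ p ∣ * ∣ q ∣
    archimedean : ∀ {ε} → 0# < ε → ∃[ N ] 1# ≤ ε * ⟦ + suc N ⟧

module Convergence (𝔽 : OrderedField) where

  open OrderedField 𝔽

  commutativeRing : CommutativeRing _ _
  commutativeRing = record { isCommutativeRing = isCommutativeRing }

  open IsCommutativeRing isCommutativeRing
    using (+-identityˡ; +-identityʳ; *-identityˡ; *-identityʳ; *-assoc; *-comm)
    renaming (-‿inverseʳ to +-inverseʳ; distribˡ to *-distribˡ-+; distribʳ to *-distribʳ-+; zeroˡ to *-zeroˡ; zeroʳ to *-zeroʳ)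

  open Exp (CommutativeRing.commutativeSemiring commutativeRing) public
    using (_^_; ^-homo-*; ^-assocʳ; ^-distrib-*)

  ℤ⟶𝔽 : ℤ.+-*-rawRing -Raw-AlmostCommutative⟶ fromCommutativeRing commutativeRing
  ℤ⟶𝔽 = record
    { ⟦_⟧ = ⟦_⟧ ; +-homo = +-homo ; *-homo = *-homo ; -‿homo = -‿homo ; 0-homo = refl ; 1-homo = refl }

  module +-*-Solver = RingSolver ℤ.+-*-rawRing (fromCommutativeRing commutativeRing) ℤ⟶𝔽
    (λ m n → Maybe.map (cong ⟦_⟧) (dec⇒weaklyDec ℤP._≟_ m n))

  infixl 6 _-_

  _-_ : F → F → F
  p - q = p + - q

  fromℕ : ℕ → F
  fromℕ n = ⟦ + n ⟧

  ≤-refl : ∀ {p} → p ≤ p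
  ≤-refl = ≤-reflexive refl

  <-respˡ-≡ : ∀ {p q r} → p ≡ q → p < r → q < r
  <-respˡ-≡ refl p<r = p<r

  <-respʳ-≡ : ∀ {p q r} → p ≡ q → r < p → r < q
  <-respʳ-≡ refl r<p = r<p

  +-monoˡ-≤ : ∀ r {p q} → p ≤ q → p + r ≤ q + r
  +-monoˡ-≤ r p≤q = +-mono-≤ p≤q ≤-refl

  +-monoʳ-≤ : ∀ r {p q} → p ≤ q → r + p ≤ r + q
  +-monoʳ-≤ r p≤q = +-mono-≤ ≤-refl p≤q

  +-monoˡ-< : ∀ r {p q} → p < q → p + r < q + r
  +-monoˡ-< r p<q = +-mono-<-≤ p<q ≤-refl

  +-mono-< : ∀ {p q r s} → p < q → r < s → p + r < q + s
  +-mono-< p<q r<s = +-mono-<-≤ p<q (<⇒≤ r<s)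

  *-monoˡ-< : ∀ {r p q} → 0# < r → p < q → r * p < r * q
  *-monoˡ-< {r} {p} {q} 0<r p<q = <-respˡ-≡ (*-comm p r) (<-respʳ-≡ (*-comm q r) (*-monoʳ-< 0<r p<q))

  ∣p-q∣≤∣p∣+∣q∣ : ∀ p q → ∣ p - q ∣ ≤ ∣ p ∣ + ∣ q ∣
  ∣p-q∣≤∣p∣+∣q∣ p q = ≤-trans (∣p+q∣≤∣p∣+∣q∣ p (- q)) (≤-reflexive (cong (λ t → ∣ p ∣ + t) (∣-p∣≡∣p∣ q)))

  pos⇒≢0 : ∀ {q} → 0# < q → q ≢ 0#
  pos⇒≢0 0<q q≡0 = <-irrefl (sym q≡0) 0<q

  ⁻¹-inv⁺ : ∀ {q} → 0# < q → q * q ⁻¹ ≡ 1#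
  ⁻¹-inv⁺ 0<q = ⁻¹-inverse (pos⇒≢0 0<q)

  *-monoʳ : ∀ {r p q} → 0# ≤ r → p ≤ q → p * r ≤ q * r
  *-monoʳ {r} {p} {q} 0≤r p≤q = subst₂ _≤_ (*-comm r p) (*-comm r q) (*-monoˡ 0≤r p≤q)

  *-mono : ∀ {p q r s} → 0# ≤ r → 0# ≤ q → p ≤ q → r ≤ s → p * r ≤ q * s
  *-mono 0≤r 0≤q p≤q r≤s = ≤-trans (*-monoʳ 0≤r p≤q) (*-monoˡ 0≤q r≤s)

  *-pos : ∀ {p q} → 0# < p → 0# < q → 0# < p * q
  *-pos {p} {q} 0<p 0<q = <-respˡ-≡ (*-zeroˡ q) (*-monoʳ-< 0<q 0<p)

  *-nonNeg : ∀ {p q} → 0# ≤ p → 0# ≤ q → 0# ≤ p * q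
  *-nonNeg {p} {q} 0≤p 0≤q = subst (_≤ p * q) (*-zeroʳ p) (*-monoˡ 0≤p 0≤q)

  +-pos : ∀ {p q} → 0# < p → 0# ≤ q → 0# < p + q
  +-pos {p} {q} 0<p 0≤q = subst (_< p + q) (+-identityʳ 0#) (+-mono-<-≤ 0<p 0≤q)

  +-nonNeg : ∀ {p q} → 0# ≤ p → 0# ≤ q → 0# ≤ p + q
  +-nonNeg {p} {q} 0≤p 0≤q = subst (_≤ p + q) (+-identityʳ 0#) (+-mono-≤ 0≤p 0≤q)

  *-cancelʳ : ∀ {r p q} → 0# < r → p * r ≤ q * r → p ≤ q
  *-cancelʳ 0<r le = ≮⇒≥ λ q<p → <-irrefl refl (<-≤-trans (*-monoʳ-< 0<r q<p) le)

  *-cancelʳ-< : ∀ {r p q} → 0# ≤ r → p * r < q * r → p < q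
  *-cancelʳ-< 0≤r lt = ≰⇒> λ q≤p → <-irrefl refl (<-≤-trans lt (*-monoʳ 0≤r q≤p))

  ⁻¹-pos : ∀ {q} → 0# < q → 0# < q ⁻¹
  ⁻¹-pos {q} 0<q = ≰⇒> λ q⁻¹≤0 → <-irrefl refl
    (<-≤-trans 0<1 (subst₂ _≤_ (⁻¹-inv⁺ 0<q) (*-zeroʳ q) (*-monoˡ (<⇒≤ 0<q) q⁻¹≤0)))

  0≤²  : ∀ p → 0# ≤ p * p
  0≤² p with ≤-total 0# p
  ... | inj₁ 0≤p = *-nonNeg 0≤p 0≤p
  ... | inj₂ p≤0 = subst (0# ≤_) (solve 1 (λ a → (:- a) :* (:- a) := a :* a) refl p)
                     (*-nonNeg 0≤-p 0≤-p)
    where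
    open +-*-Solver
    0≤-p = ≤-trans (≤-reflexive (-‿homo 0ℤ)) (neg-antimono-≤ p≤0)

  diff⇒≤ : ∀ {p q} → 0# ≤ q - p → p ≤ q
  diff⇒≤ {p} {q} 0≤d = subst₂ _≤_ (+-identityˡ p)
    (solve 2 (λ a b → b :- a :+ a := b) refl p q) (+-monoˡ-≤ p 0≤d)
    where open +-*-Solver

  ≤⇒diff : ∀ {p q} → p ≤ q → 0# ≤ q - p
  ≤⇒diff {p} {q} p≤q = subst (_≤ q - p) (+-inverseʳ p) (+-monoˡ-≤ (- p) p≤q)

  fromℕ-+ : ∀ m n → fromℕ (m ℕ.+ n) ≡ fromℕ m + fromℕ n
  fromℕ-+ m n = +-homo (+ m) (+ n)

  fromℕ-* : ∀ m n → fromℕ (m ℕ.* n) ≡ fromℕ m * fromℕ n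
  fromℕ-* m n = trans (cong ⟦_⟧ (ℤP.pos-* m n)) (*-homo (+ m) (+ n))

  fromℕ-^ : ∀ m n → fromℕ (m ℕ.^ n) ≡ fromℕ m ^ n
  fromℕ-^ m zero    = refl
  fromℕ-^ m (suc n) = trans (fromℕ-* m (m ℕ.^ n)) (cong (fromℕ m *_) (fromℕ-^ m n))

  fromℕ-suc : ∀ n → fromℕ (suc n) ≡ 1# + fromℕ n
  fromℕ-suc = fromℕ-+ 1

  fromℕ-nonNeg : ∀ n → 0# ≤ fromℕ n
  fromℕ-nonNeg zero    = ≤-refl
  fromℕ-nonNeg (suc n) = subst (0# ≤_) (sym (fromℕ-suc n)) (+-nonNeg (<⇒≤ 0<1) (fromℕ-nonNeg n))

  fromℕ-pos : ∀ n → 0# < fromℕ (suc n)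
  fromℕ-pos n = <-respʳ-≡ (sym (fromℕ-suc n)) (+-pos 0<1 (fromℕ-nonNeg n))

  fromℕ-pos′ : ∀ n → .{{ℕ.NonZero n}} → 0# < fromℕ n
  fromℕ-pos′ (suc n) = fromℕ-pos n

  fromℕ-mono : ∀ {m n} → m ℕ.≤ n → fromℕ m ≤ fromℕ n
  fromℕ-mono {m} {n} m≤n =
    subst (fromℕ m ≤_) (trans (sym (fromℕ-+ m (n ℕ.∸ m))) (cong fromℕ (ℕP.m+[n∸m]≡n m≤n)))
      (subst (_≤ fromℕ m + fromℕ (n ℕ.∸ m)) (+-identityʳ (fromℕ m))
        (+-monoʳ-≤ (fromℕ m) (fromℕ-nonNeg (n ℕ.∸ m))))

  Cauchy : (ℕ → F) → Set
  Cauchy a = ∀ {ε} → 0# < ε → ∃[ N ] ∀ {m n} → N ℕ.≤ m → N ℕ.≤ n → ∣ a m - a n ∣ < ε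

  Apart0 : (ℕ → F) → Set
  Apart0 a = ∃[ δ ] 0# < δ × (∃[ N ] ∀ {n} → N ℕ.≤ n → δ ≤ ∣ a n ∣)

  const-cauchy : ∀ q → Cauchy (λ _ → q)
  const-cauchy q 0<ε = 0 , λ _ _ → <-respˡ-≡ (sym (trans (cong ∣_∣ (+-inverseʳ q)) (0≤p⇒∣p∣≡p ≤-refl))) 0<ε

  +-cauchy : ∀ {a b} → Cauchy a → Cauchy b → Cauchy (λ n → a n + b n)
  +-cauchy {a} {b} ca cb {ε} 0<ε = M ℕ.⊔ N , λ {m} {n} m≥ n≥ →
    <-respˡ-≡ (cong ∣_∣ (lem (a m) (a n) (b m) (b n)))
      (≤-<-trans (∣p+q∣≤∣p∣+∣q∣ (a m - a n) (b m - b n))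
        (<-respʳ-≡ half
          (+-mono-< (hM (ℕP.m⊔n≤o⇒m≤o M N m≥) (ℕP.m⊔n≤o⇒m≤o M N n≥))
                    (hN (ℕP.m⊔n≤o⇒n≤o M N m≥) (ℕP.m⊔n≤o⇒n≤o M N n≥)))))
    where
    open +-*-Solver
    lem : ∀ x y z w → (x - y) + (z - w) ≡ (x + z) - (y + w)
    lem = solve 4 (λ x y z w → (x :- y) :+ (z :- w) := (x :+ z) :- (y :+ w)) refl
    half : ε * ½ + ε * ½ ≡ ε
    half = trans (sym (*-distribˡ-+ ε ½ ½)) (trans (cong (ε *_) ½+½≡1) (*-identityʳ ε))
    0<ε/2 = *-pos 0<ε 0<½
    M = proj₁ (ca 0<ε/2) ; hM = proj₂ (ca 0<ε/2)
    N = proj₁ (cb 0<ε/2) ; hN = proj₂ (cb 0<ε/2)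

  bounded : ∀ {a} → Cauchy a → ∃[ B ] 0# < B × (∃[ N ] ∀ {n} → N ℕ.≤ n → ∣ a n ∣ ≤ B)
  bounded {a} ca = 1# + ∣ a N ∣ , +-pos 0<1 (0≤∣p∣ (a N)) , N , λ {n} n≥ →
    subst (_≤ 1# + ∣ a N ∣) (cong ∣_∣ (lem (a n) (a N)))
      (≤-trans (∣p+q∣≤∣p∣+∣q∣ (a n - a N) (a N)) (+-monoˡ-≤ ∣ a N ∣ (<⇒≤ (h n≥ ℕP.≤-refl))))
    where
    open +-*-Solver
    N = proj₁ (ca 0<1) ; h = proj₂ (ca 0<1)
    lem : ∀ x y → (x - y) + y ≡ x
    lem = solve 2 (λ x y → (x :- y) :+ y := x) refl

  *-cauchy : ∀ {a b} → Cauchy a → Cauchy b → Cauchy (λ n → a n * b n)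
  *-cauchy {a} {b} ca cb {ε} 0<ε with bounded ca | bounded cb
  ... | A , 0<A , K , hK | B , 0<B , L , hL = (M ℕ.⊔ N) ℕ.⊔ (K ℕ.⊔ L) , λ {m} {n} m≥ n≥ →
    let m≥₁ = ℕP.m⊔n≤o⇒m≤o (M ℕ.⊔ N) _ m≥
        n≥₁ = ℕP.m⊔n≤o⇒m≤o (M ℕ.⊔ N) _ n≥
        m≥₂ = ℕP.m⊔n≤o⇒n≤o (M ℕ.⊔ N) _ m≥
        n≥₂ = ℕP.m⊔n≤o⇒n≤o (M ℕ.⊔ N) _ n≥
    in <-respˡ-≡ (cong ∣_∣ (lem (a m) (a n) (b m) (b n)))
      (≤-<-trans (∣p+q∣≤∣p∣+∣q∣ (a m * (b m - b n)) (b n * (a m - a n)))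
        (<-respʳ-≡ split
          (+-mono-<
            (bound A (a m) (b m - b n) 0<A (hK (ℕP.m⊔n≤o⇒m≤o K L m≥₂)) (hN (ℕP.m⊔n≤o⇒n≤o M N m≥₁) (ℕP.m⊔n≤o⇒n≤o M N n≥₁)))
            (bound B (b n) (a m - a n) 0<B (hL (ℕP.m⊔n≤o⇒n≤o K L n≥₂)) (hM (ℕP.m⊔n≤o⇒m≤o M N m≥₁) (ℕP.m⊔n≤o⇒m≤o M N n≥₁))))))
    where
    open +-*-Solver
    0<A+B = +-pos 0<A (<⇒≤ 0<B)
    η = ε * (A + B) ⁻¹
    0<η = *-pos 0<ε (⁻¹-pos 0<A+B)
    M = proj₁ (ca 0<η) ; hM = proj₂ (ca 0<η)
    N = proj₁ (cb 0<η) ; hN = proj₂ (cb 0<η)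
    lem : ∀ x y z w → x * (z - w) + w * (x - y) ≡ x * z - y * w
    lem = solve 4 (λ x y z w → x :* (z :- w) :+ w :* (x :- y) := x :* z :- y :* w) refl
    lem₂ : ∀ a b e i → a * (e * i) + b * (e * i) ≡ e * ((a + b) * i)
    lem₂ = solve 4 (λ a b e i → a :* (e :* i) :+ b :* (e :* i) := e :* ((a :+ b) :* i)) refl
    bound : ∀ R x y → 0# < R → ∣ x ∣ ≤ R → ∣ y ∣ < η → ∣ x * y ∣ < R * η
    bound R x y 0<R x≤ y< = ≤-<-trans
      (≤-trans (≤-reflexive (∣p*q∣≡∣p∣*∣q∣ x y)) (*-monoʳ (0≤∣p∣ y) x≤))
      (*-monoˡ-< 0<R y<)
    split : A * η + B * η ≡ ε
    split = trans (lem₂ A B ε ((A + B) ⁻¹))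
              (trans (cong (ε *_) (⁻¹-inv⁺ 0<A+B)) (*-identityʳ ε))

  ∣∣>0⇒≢0 : ∀ {δ q} → 0# < δ → δ ≤ ∣ q ∣ → q ≢ 0#
  ∣∣>0⇒≢0 0<δ δ≤ refl = <-irrefl refl (<-≤-trans 0<δ (≤-trans δ≤ (≤-reflexive (0≤p⇒∣p∣≡p ≤-refl))))

  ⁻¹-cauchy : ∀ {a} → Apart0 a → Cauchy a → Cauchy (λ n → a n ⁻¹)
  ⁻¹-cauchy {a} (δ , 0<δ , K , hK) ca {ε} 0<ε = K ℕ.⊔ N , λ {m} {n} m≥ n≥ →
    main (a m) (a n) (hK (ℕP.m⊔n≤o⇒m≤o K N m≥)) (hK (ℕP.m⊔n≤o⇒m≤o K N n≥))
      (hN (ℕP.m⊔n≤o⇒n≤o K N n≥) (ℕP.m⊔n≤o⇒n≤o K N m≥))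
    where
    open +-*-Solver
    0<η = *-pos 0<ε (*-pos 0<δ 0<δ)
    N = proj₁ (ca 0<η) ; hN = proj₂ (ca 0<η)
    main : ∀ x y → δ ≤ ∣ x ∣ → δ ≤ ∣ y ∣ → ∣ y - x ∣ < ε * (δ * δ) → ∣ x ⁻¹ - y ⁻¹ ∣ < ε
    main x y δ≤x δ≤y d< = *-cancelʳ-< (<⇒≤ (*-pos 0<δ 0<δ))
      (≤-<-trans
        (≤-trans (*-monoˡ (0≤∣p∣ (x ⁻¹ - y ⁻¹)) (*-mono (<⇒≤ 0<δ) (0≤∣p∣ x) δ≤x δ≤y))
          (≤-reflexive eq))
        d<)
      where
      X = x ⁻¹
      Y = y ⁻¹
      eq : ∣ X - Y ∣ * (∣ x ∣ * ∣ y ∣) ≡ ∣ y - x ∣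
      eq = trans (cong (∣ X - Y ∣ *_) (sym (∣p*q∣≡∣p∣*∣q∣ x y)))
        (trans (sym (∣p*q∣≡∣p∣*∣q∣ (X - Y) (x * y)))
        (cong ∣_∣ (trans
          (solve 4 (λ x y X Y → (X :- Y) :* (x :* y) := (x :* X) :* y :- (y :* Y) :* x) refl x y X Y)
          (trans (cong₂ (λ s t → s * y - t * x) (⁻¹-inverse (∣∣>0⇒≢0 0<δ δ≤x)) (⁻¹-inverse (∣∣>0⇒≢0 0<δ δ≤y)))
            (solve 2 (λ x y → con 1ℤ :* y :- con 1ℤ :* x := y :- x) refl x y)))))

  *-apart0 : ∀ {a b} → Apart0 a → Apart0 b → Apart0 (λ n → a n * b n)
  *-apart0 {a} {b} (δ , 0<δ , M , hM) (η , 0<η , N , hN) = δ * η , *-pos 0<δ 0<η , M ℕ.⊔ N , λ {n} n≥ →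
    ≤-trans (*-mono (<⇒≤ 0<η) (0≤∣p∣ (a n)) (hM (ℕP.m⊔n≤o⇒m≤o M N n≥)) (hN (ℕP.m⊔n≤o⇒n≤o M N n≥)))
      (≤-reflexive (sym (∣p*q∣≡∣p∣*∣q∣ (a n) (b n))))

  const-apart0 : ∀ {q} → 0# < q → Apart0 (λ _ → q)
  const-apart0 {q} 0<q = q , 0<q , 0 , λ _ → ≤-reflexive (sym (0≤p⇒∣p∣≡p (<⇒≤ 0<q)))

  rising : F → ℕ → F
  rising x zero    = 1#
  rising x (suc k) = rising x k * (x + fromℕ k)


  euler : F → (p q : ℕ) → ℕ → F
  euler x p q n = fromℕ (k !) * rising x k ⁻¹ * (fromℕ r ^ p * (fromℕ r ^ q) ⁻¹)
    where
    r = suc n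
    k = r ℕ.^ q

  Good : (ℕ → F) → Set
  Good a = Cauchy a × Apart0 a

  good-cong : ∀ {a b} → (∀ n → a n ≡ b n) → Good a → Good b
  good-cong eq (ca , δ , 0<δ , N , h) =
    (λ 0<ε → proj₁ (ca 0<ε) , λ {m} {n} m≥ n≥ →
      <-respˡ-≡ (cong₂ (λ s t → ∣ s - t ∣) (eq m) (eq n)) (proj₂ (ca 0<ε) m≥ n≥)) ,
    δ , 0<δ , N , λ {n} n≥ → subst (λ t → δ ≤ ∣ t ∣) (eq n) (h n≥)

  good-* : ∀ {a b} → Good a → Good b → Good (λ n → a n * b n)
  good-* (ca , ha) (cb , hb) = *-cauchy ca cb , *-apart0 ha hb

  ∣-∣-sym : ∀ a b → ∣ a - b ∣ ≡ ∣ b - a ∣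
  ∣-∣-sym a b = trans (cong ∣_∣ (solve 2 (λ a b → a :- b := :- (b :- a)) refl a b)) (∣-p∣≡∣p∣ (b - a))
    where open +-*-Solver

  rate⇒cauchy : ∀ {a R} → 0# ≤ R → (∀ {m n} → m ℕ.≤ n → ∣ a m - a n ∣ * fromℕ (suc m) ≤ R) → Cauchy a
  rate⇒cauchy {a} {R} 0≤R h {ε} 0<ε = N , main
    where
    open +-*-Solver
    0<1+R = +-pos 0<1 0≤R
    N,h = archimedean (*-pos 0<ε (⁻¹-pos 0<1+R))
    N = proj₁ N,h
    R<εN : R < ε * fromℕ (suc N)
    R<εN = <-≤-trans (<-respˡ-≡ (+-identityˡ R) (+-monoˡ-< R 0<1))
      (subst₂ _≤_ (*-identityʳ (1# + R))
        (trans (solve 4 (λ s e i t → s :* (e :* i :* t) := e :* t :* (s :* i)) refl (1# + R) ε ((1# + R) ⁻¹) (fromℕ (suc N)))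
          (trans (cong (ε * fromℕ (suc N) *_) (⁻¹-inv⁺ 0<1+R)) (*-identityʳ _)))
        (*-monoˡ (<⇒≤ 0<1+R) (proj₂ N,h)))
    ordered : ∀ {m n} → N ℕ.≤ m → m ℕ.≤ n → ∣ a m - a n ∣ < ε
    ordered {m} m≥ m≤n = *-cancelʳ-< (fromℕ-nonNeg (suc m))
      (≤-<-trans (h m≤n) (<-≤-trans R<εN (*-monoˡ (<⇒≤ 0<ε) (fromℕ-mono (s≤s m≥)))))
    main : ∀ {m n} → N ℕ.≤ m → N ℕ.≤ n → ∣ a m - a n ∣ < ε
    main {m} {n} m≥ n≥ with ℕP.≤-total m n
    ... | inj₁ m≤n = ordered m≥ m≤n
    ... | inj₂ n≤m = <-respˡ-≡ (∣-∣-sym (a n) (a m)) (ordered n≥ n≤m)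

  null⇒cauchy : ∀ {a R} → 0# ≤ R → (∀ n → ∣ a n ∣ * fromℕ (suc n) ≤ R) → Cauchy a
  null⇒cauchy {a} {R} 0≤R h = rate⇒cauchy (+-nonNeg 0≤R 0≤R) λ {m} {n} m≤n →
    ≤-trans (*-monoʳ (fromℕ-nonNeg (suc m)) (∣p-q∣≤∣p∣+∣q∣ (a m) (a n)))
      (≤-trans (≤-reflexive (*-distribʳ-+ (fromℕ (suc m)) ∣ a m ∣ ∣ a n ∣))
        (+-mono-≤ (h m) (≤-trans (*-monoˡ (0≤∣p∣ (a n)) (fromℕ-mono (s≤s m≤n))) (h n))))

  ^-pos : ∀ {a} n → 0# < a → 0# < a ^ n
  ^-pos zero    0<a = 0<1
  ^-pos (suc n) 0<a = *-pos 0<a (^-pos n 0<a)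

  ^-nonNeg : ∀ {a} n → 0# ≤ a → 0# ≤ a ^ n
  ^-nonNeg zero    0≤a = <⇒≤ 0<1
  ^-nonNeg (suc n) 0≤a = *-nonNeg 0≤a (^-nonNeg n 0≤a)

  ^-mono : ∀ {a b} n → 0# ≤ a → a ≤ b → a ^ n ≤ b ^ n
  ^-mono zero    0≤a a≤b = ≤-refl
  ^-mono (suc n) 0≤a a≤b = *-mono (^-nonNeg n 0≤a) (≤-trans 0≤a a≤b) a≤b (^-mono n 0≤a a≤b)

  ^-cancel : ∀ {a b} n → .{{ℕ.NonZero n}} → 0# ≤ b → a ^ n ≤ b ^ n → a ≤ b
  ^-cancel {a} {b} (suc n) 0≤b le = ≮⇒≥ λ b<a →
    let 0<a = ≤-<-trans 0≤b b<a in
    <-irrefl refl (≤-<-trans le (≤-<-trans (*-monoˡ 0≤b (^-mono n 0≤b (<⇒≤ b<a)))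
      (*-monoʳ-< (^-pos n 0<a) b<a)))

  1^ : ∀ n → 1# ^ n ≡ 1#
  1^ zero    = refl
  1^ (suc n) = trans (*-identityˡ _) (1^ n)

  ^-inv : ∀ {a b} n → a * b ≡ 1# → a ^ n * b ^ n ≡ 1#
  ^-inv {a} {b} n ab≡1 = trans (sym (^-distrib-* a b n)) (trans (cong (_^ n) ab≡1) (1^ n))

  bernoulli : ∀ {M c} n → 0# ≤ M → 0# ≤ c → M ^ n * (fromℕ (suc n) * c - fromℕ n * M) ≤ c ^ suc n
  bernoulli {M} {c} zero _ _ = ≤-reflexive (solve 2 (λ M c → con 1ℤ :* (con 1ℤ :* c :- con 0ℤ :* M) := c :* con 1ℤ) refl M c)
    where open +-*-Solver
  bernoulli {M} {c} (suc n) 0≤M 0≤c = ≤-trans (diff⇒≤ (subst (0# ≤_) eq 0≤)) (*-monoˡ 0≤c (bernoulli n 0≤M 0≤c))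
    where
    open +-*-Solver
    f = fromℕ n
    0≤ : 0# ≤ (1# + f) * (M ^ n * ((c - M) * (c - M)))
    0≤ = *-nonNeg (+-nonNeg (<⇒≤ 0<1) (fromℕ-nonNeg n)) (*-nonNeg (^-nonNeg n 0≤M) (0≤² (c - M)))
    eq : (1# + f) * (M ^ n * ((c - M) * (c - M)))
         ≡ c * (M ^ n * (fromℕ (suc n) * c - f * M)) - M ^ suc n * (fromℕ (suc (suc n)) * c - fromℕ (suc n) * M)
    eq rewrite fromℕ-suc (suc n) | fromℕ-suc n =
      solve 4 (λ f P M c → (con 1ℤ :+ f) :* (P :* ((c :- M) :* (c :- M)))
        := c :* (P :* ((con 1ℤ :+ f) :* c :- f :* M))
           :- M :* P :* ((con 1ℤ :+ (con 1ℤ :+ f)) :* c :- (con 1ℤ :+ f) :* M)) refl f (M ^ n) M c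

  -- Weighted AM–GM for two numbers.
  amgm : ∀ m n {a b M} → .{{ℕ.NonZero m}} → 0# ≤ a → 0# ≤ b → 0# ≤ M →
         fromℕ (m ℕ.+ n) * M ≡ fromℕ m * a + fromℕ n * b → a ^ m * b ^ n ≤ M ^ (m ℕ.+ n)
  amgm m zero {a} {b} {M} _ _ _ eq rewrite ℕP.+-identityʳ m = ≤-reflexive
    (trans (*-identityʳ (a ^ m)) (cong (_^ m) (sym (≤-antisym (*-cancelʳ (fromℕ-pos′ m) (≤-reflexive M≡a))
      (*-cancelʳ (fromℕ-pos′ m) (≤-reflexive (sym M≡a)))))))
    where
    open +-*-Solver
    M≡a : M * fromℕ m ≡ a * fromℕ m
    M≡a = trans (*-comm M (fromℕ m)) (trans eq
      (solve 3 (λ m a b → m :* a :+ con 0ℤ :* b := a :* m) refl (fromℕ m) a b))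
  amgm m@(suc l) (suc n) {a} {b} {c} 0≤a 0≤b 0≤c eq rewrite ℕP.+-suc l n =
    ≤-trans (≤-reflexive (solve 3 (λ s b t → s :* (b :* t) := s :* t :* b) refl (a ^ m) b (b ^ n)))
      (≤-trans (*-monoʳ 0≤b (amgm m n 0≤a 0≤b 0≤M eqM))
        (≤-trans (≤-reflexive (cong (M ^ N *_) b≡)) (bernoulli N 0≤M 0≤c)))
    where
    open +-*-Solver
    N = m ℕ.+ n
    S = fromℕ m * a + fromℕ n * b
    M = S * fromℕ N ⁻¹
    0≤M : 0# ≤ M
    0≤M = *-nonNeg (+-nonNeg (*-nonNeg (fromℕ-nonNeg m) 0≤a) (*-nonNeg (fromℕ-nonNeg n) 0≤b)) (<⇒≤ (⁻¹-pos (fromℕ-pos′ N)))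
    eqM : fromℕ N * M ≡ S
    eqM = trans (solve 3 (λ n s i → n :* (s :* i) := s :* (n :* i)) refl (fromℕ N) S (fromℕ N ⁻¹))
      (trans (cong (S *_) (⁻¹-inv⁺ (fromℕ-pos′ N))) (*-identityʳ S))
    b≡ : b ≡ fromℕ (suc N) * c - fromℕ N * M
    b≡ = sym (trans (cong₂ _-_ (trans eq (cong (λ t → fromℕ m * a + t * b) (fromℕ-suc n))) eqM)
      (solve 4 (λ m a n b → (m :* a :+ (con 1ℤ :+ n) :* b) :- (m :* a :+ n :* b) := b) refl (fromℕ m) a (fromℕ n) b))

  *≡1 : ∀ {a b} → a ≡ 1# → b ≡ 1# → a * b ≡ 1#
  *≡1 refl refl = *-identityˡ 1#

  rising-pos : ∀ {x} k → 0# < x → 0# < rising x k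
  rising-pos zero    0<x = 0<1
  rising-pos (suc k) 0<x = *-pos (rising-pos k 0<x) (+-pos 0<x (fromℕ-nonNeg k))

  ⁻¹-unique : ∀ {a b} → 0# < a → a * b ≡ 1# → a ⁻¹ ≡ b
  ⁻¹-unique {a} {b} 0<a ab≡1 = trans (sym (*-identityʳ (a ⁻¹))) (trans (cong (a ⁻¹ *_) (sym ab≡1))
    (trans (solve 3 (λ i a b → i :* (a :* b) := (a :* i) :* b) refl (a ⁻¹) a b)
      (trans (cong (_* b) (⁻¹-inv⁺ 0<a)) (*-identityˡ b))))
    where open +-*-Solver

  ⁻¹-* : ∀ {a b} → 0# < a → 0# < b → (a * b) ⁻¹ ≡ a ⁻¹ * b ⁻¹
  ⁻¹-* {a} {b} 0<a 0<b = ⁻¹-unique (*-pos 0<a 0<b)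
    (trans (solve 4 (λ a b i j → a :* b :* (i :* j) := (a :* i) :* (b :* j)) refl a b (a ⁻¹) (b ⁻¹))
      (*≡1 (⁻¹-inv⁺ 0<a) (⁻¹-inv⁺ 0<b)))
    where open +-*-Solver

  m+n≢0 : ∀ m n → .{{ℕ.NonZero n}} → ℕ.NonZero (m ℕ.+ n)
  m+n≢0 m (suc n) = subst ℕ.NonZero (sym (ℕP.+-suc m n)) _

  module Base (x : F) (0<x : 0# < x) (p d : ℕ) .{{_ : ℕ.NonZero p}}
              (x≡ : x * fromℕ (p ℕ.+ d) ≡ fromℕ p) where

    q = p ℕ.+ d

    instance
      q≢0 : ℕ.NonZero q
      q≢0 = ℕ.>-nonZero (ℕP.<-≤-trans (ℕ.>-nonZero⁻¹ p) (ℕP.m≤m+n p d))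

    w v c e : ℕ → F
    w k = fromℕ (k !) * rising x k ⁻¹
    v k = fromℕ k ⁻¹
    c k = w k ^ q * v k ^ d
    e k = w k ^ q * v (suc k) ^ d

    w-pos : ∀ k → 0# < w k
    w-pos k = *-pos (fromℕ-pos′ (k !) {{k ℕP.!≢0}}) (⁻¹-pos (rising-pos k 0<x))

    v-pos : ∀ k → .{{ℕ.NonZero k}} → 0# < v k
    v-pos k = ⁻¹-pos (fromℕ-pos′ k)

    open +-*-Solver

    module Step (i : ℕ) .{{_ : ℕ.NonZero i}} where
      I  = fromℕ i
      I₁ = fromℕ (suc i)
      I₂ = fromℕ (suc (suc i))
      V  = v i
      V₁ = v (suc i)
      V₂ = v (suc (suc i))
      0<x+I = +-pos 0<x (fromℕ-nonNeg i)
      J  = (x + I) ⁻¹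
      0<J = ⁻¹-pos 0<x+I

      w-suc : w (suc i) ≡ w i * (I₁ * J)
      w-suc = trans (cong₂ _*_ (fromℕ-* (suc i) (i !)) (⁻¹-* (rising-pos i 0<x) 0<x+I))
        (solve 4 (λ a b s t → a :* b :* (s :* t) := b :* s :* (a :* t)) refl I₁ (fromℕ (i !)) (rising x i ⁻¹) J)

      am₁ : I₁ ^ p * I ^ d ≤ (x + I) ^ q
      am₁ = amgm p d (fromℕ-nonNeg (suc i)) (fromℕ-nonNeg i) (<⇒≤ 0<x+I)
        (trans (trans (*-comm (fromℕ q) (x + I)) (*-distribʳ-+ (fromℕ q) x I))
        (trans (cong₂ (λ s t → s + I * t) x≡ (fromℕ-+ p d))
        (trans (solve 3 (λ p d I → p :+ I :* (p :+ d) := p :* (con 1ℤ :+ I) :+ d :* I) refl (fromℕ p) (fromℕ d) I)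
          (cong (λ t → fromℕ p * t + fromℕ d * I) (sym (fromℕ-suc i))))))

      am₂ : (x + I) ^ q * I₂ ^ d ≤ I₁ ^ (q ℕ.+ d)
      am₂ = amgm q d (<⇒≤ 0<x+I) (fromℕ-nonNeg (suc (suc i))) (fromℕ-nonNeg (suc i)) (sym
        (trans (cong₂ _+_ (trans (*-comm (fromℕ q) (x + I)) (*-distribʳ-+ (fromℕ q) x I)) (cong (fromℕ d *_) (trans (fromℕ-suc (suc i)) (cong (λ t → 1# + t) (fromℕ-suc i)))))
        (trans (cong (λ s → s + I * fromℕ q + fromℕ d * (1# + (1# + I))) x≡)
        (trans (cong (λ s → fromℕ p + I * s + fromℕ d * (1# + (1# + I))) (fromℕ-+ p d))
        (trans (solve 3 (λ p d I → p :+ I :* (p :+ d) :+ d :* (con 1ℤ :+ (con 1ℤ :+ I)) := (p :+ d :+ d) :* (con 1ℤ :+ I)) refl (fromℕ p) (fromℕ d) I)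
          (sym (cong₂ _*_ (trans (fromℕ-+ q d) (cong (_+ fromℕ d) (fromℕ-+ p d))) (fromℕ-suc i))))))))

      c-dec : c (suc i) ≤ c i
      c-dec = ≤-trans (≤-reflexive eq₁) (≤-trans (*-monoˡ (<⇒≤ 0<K) am₁) (≤-reflexive eq₂))
        where
        K = w i ^ q * J ^ q * V ^ d
        0<K = *-pos (*-pos (^-pos q (w-pos i)) (^-pos q 0<J)) (^-pos d (v-pos i))
        eq₁ : c (suc i) ≡ K * (I₁ ^ p * I ^ d)
        eq₁ = trans (cong (λ t → t ^ q * V₁ ^ d) w-suc)
          (trans (cong (_* V₁ ^ d) (trans (^-distrib-* (w i) (I₁ * J) q) (cong (w i ^ q *_) (trans (^-distrib-* I₁ J q) (cong (_* J ^ q) (^-homo-* I₁ p d))))))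
          (trans (solve 5 (λ W P D j U → W :* (P :* D :* j) :* U := W :* j :* P :* (D :* U)) refl (w i ^ q) (I₁ ^ p) (I₁ ^ d) (J ^ q) (V₁ ^ d))
          (trans (cong (w i ^ q * J ^ q * I₁ ^ p *_) (trans (^-inv d (⁻¹-inv⁺ (fromℕ-pos i))) (sym (^-inv d (⁻¹-inv⁺ (fromℕ-pos′ i))))))
            (solve 5 (λ W j P D U → W :* j :* P :* (D :* U) := W :* j :* U :* (P :* D)) refl (w i ^ q) (J ^ q) (I₁ ^ p) (I ^ d) (V ^ d)))))
        eq₂ : K * (x + I) ^ q ≡ c i
        eq₂ = trans (solve 4 (λ W j U X → W :* j :* U :* X := W :* U :* (X :* j)) refl (w i ^ q) (J ^ q) (V ^ d) ((x + I) ^ q))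
          (trans (cong (c i *_) (^-inv q (⁻¹-inv⁺ 0<x+I))) (*-identityʳ (c i)))

      e-inc : e i ≤ e (suc i)
      e-inc = ≤-trans (≤-reflexive (sym eq₁)) (≤-trans (*-monoˡ (<⇒≤ 0<K) am₂) (≤-reflexive (sym eq₂)))
        where
        K = w i ^ q * J ^ q * (V₁ ^ d * V₂ ^ d)
        0<K = *-pos (*-pos (^-pos q (w-pos i)) (^-pos q 0<J)) (*-pos (^-pos d (v-pos (suc i))) (^-pos d (v-pos (suc (suc i)))))
        eq₁ : K * ((x + I) ^ q * I₂ ^ d) ≡ e i
        eq₁ = trans (solve 6 (λ W j U T X D → W :* j :* (U :* T) :* (X :* D) := W :* U :* ((X :* j) :* (D :* T))) refl
                      (w i ^ q) (J ^ q) (V₁ ^ d) (V₂ ^ d) ((x + I) ^ q) (I₂ ^ d))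
          (trans (cong (e i *_) (*≡1 (^-inv q (⁻¹-inv⁺ 0<x+I)) (^-inv d (⁻¹-inv⁺ (fromℕ-pos (suc i)))))) (*-identityʳ (e i)))
        eq₂ : e (suc i) ≡ K * I₁ ^ (q ℕ.+ d)
        eq₂ = trans (cong (λ t → t ^ q * V₂ ^ d) w-suc)
          (trans (cong (_* V₂ ^ d) (trans (^-distrib-* (w i) (I₁ * J) q) (cong (w i ^ q *_) (^-distrib-* I₁ J q))))
          (trans (sym (*-identityʳ _))
          (trans (cong (w i ^ q * (I₁ ^ q * J ^ q) * V₂ ^ d *_) (sym (^-inv d (⁻¹-inv⁺ (fromℕ-pos i)))))
          (trans (solve 6 (λ W Q j T D U → W :* (Q :* j) :* T :* (D :* U) := W :* j :* (U :* T) :* (Q :* D)) refl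
                    (w i ^ q) (I₁ ^ q) (J ^ q) (V₂ ^ d) (I₁ ^ d) (V₁ ^ d))
            (cong (K *_) (sym (^-homo-* I₁ q d)))))))

    c-mono : ∀ k → .{{ℕ.NonZero k}} → ∀ j → c (j ℕ.+ k) ≤ c k
    c-mono k zero    = ≤-refl
    c-mono k (suc j) = ≤-trans (Step.c-dec (j ℕ.+ k) {{m+n≢0 j k}}) (c-mono k j)

    e-mono : ∀ k → .{{ℕ.NonZero k}} → ∀ j → e k ≤ e (j ℕ.+ k)
    e-mono k zero    = ≤-refl
    e-mono k (suc j) = ≤-trans (e-mono k j) (Step.e-inc (j ℕ.+ k) {{m+n≢0 j k}})

    A : ℕ → F
    A = euler x p q

    k : ℕ → ℕ
    k n = suc n ℕ.^ q

    instance
      k≢0 : ∀ {n} → ℕ.NonZero (k n)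
      k≢0 {n} = ℕP.m^n≢0 (suc n) q

    module At (n : ℕ) where
      κ  = fromℕ (k n)
      ρ  = fromℕ (suc n)
      V₁ = v (suc (k n))

      0<κ : 0# < κ
      0<κ = fromℕ-pos′ (k n)

      κ≡ : κ ≡ ρ ^ q
      κ≡ = fromℕ-^ (suc n) q

      A-pos : 0# < A n
      A-pos = *-pos (w-pos (k n)) (*-pos (^-pos p (fromℕ-pos n)) (⁻¹-pos (^-pos q (fromℕ-pos n))))

      A^q : A n ^ q ≡ c (k n)
      A^q = trans (^-distrib-* (w (k n)) (ρ ^ p * (ρ ^ q) ⁻¹) q) (cong (w (k n) ^ q *_)
        (trans (^-distrib-* (ρ ^ p) ((ρ ^ q) ⁻¹) q)
        (trans (cong₂ (λ s t → s * t ⁻¹ ^ q)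
                 (trans (^-assocʳ ρ p q) (trans (cong (ρ ^_) (ℕP.*-comm p q))
                   (trans (sym (^-assocʳ ρ q p)) (cong (_^ p) (sym κ≡)))))
                 (sym κ≡))
        (trans (cong (κ ^ p *_) (^-homo-* (κ ⁻¹) p d))
        (trans (sym (*-assoc (κ ^ p) _ _))
        (trans (cong (_* κ ⁻¹ ^ d) (^-inv p (⁻¹-inv⁺ 0<κ))) (*-identityˡ _)))))))

      0<V₁ : 0# < V₁
      0<V₁ = v-pos (suc (k n))

      κV₁+V₁ : κ * V₁ + V₁ ≡ 1#
      κV₁+V₁ = trans (solve 2 (λ s t → s :* t :+ t := (con 1ℤ :+ s) :* t) refl κ V₁)
        (trans (cong (_* V₁) (sym (fromℕ-suc (k n)))) (⁻¹-inv⁺ (fromℕ-pos (k n))))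

      κV₁≤1 : κ * V₁ ≤ 1#
      κV₁≤1 = subst (κ * V₁ ≤_) κV₁+V₁ (subst (_≤ κ * V₁ + V₁) (+-identityʳ (κ * V₁)) (+-monoʳ-≤ (κ * V₁) (<⇒≤ 0<V₁)))

      0<κV₁ : 0# < κ * V₁
      0<κV₁ = *-pos 0<κ 0<V₁

      lower^q : (A n * (κ * V₁)) ^ q ≤ e (k n)
      lower^q = ≤-trans (≤-reflexive eq) (≤-trans
          (*-monoˡ (<⇒≤ (*-pos (^-pos q (w-pos (k n))) (^-pos d 0<V₁)))
            (≤-trans (^-mono p (<⇒≤ 0<κV₁) κV₁≤1) (≤-reflexive (1^ p))))
          (≤-reflexive (*-identityʳ (e (k n)))))
        where
        eq : (A n * (κ * V₁)) ^ q ≡ e (k n) * (κ * V₁) ^ p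
        eq = trans (^-distrib-* (A n) (κ * V₁) q)
          (trans (cong₂ _*_ A^q (trans (^-homo-* (κ * V₁) p d) (cong ((κ * V₁) ^ p *_) (^-distrib-* κ V₁ d))))
          (trans (solve 5 (λ W U P D T → W :* U :* (P :* (D :* T)) := W :* T :* P :* (D :* U)) refl
                   (w (k n) ^ q) (κ ⁻¹ ^ d) ((κ * V₁) ^ p) (κ ^ d) (V₁ ^ d))
          (trans (cong (e (k n) * (κ * V₁) ^ p *_) (^-inv d (⁻¹-inv⁺ 0<κ))) (*-identityʳ _))))

    open At

    e≤c : ∀ n → e (k n) ≤ c (k n)
    e≤c n = *-monoˡ (<⇒≤ (^-pos q (w-pos (k n)))) (^-mono d (<⇒≤ (0<V₁ n)) V₁≤V)
      where
      V₁≤V : V₁ n ≤ κ n ⁻¹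
      V₁≤V = *-cancelʳ (0<κ n) (subst₂ _≤_ (*-comm (κ n) (V₁ n)) (trans (sym (⁻¹-inv⁺ (0<κ n))) (*-comm (κ n) _)) (κV₁≤1 n))

    k-mono : ∀ {m n} → m ℕ.≤ n → k m ℕ.≤ k n
    k-mono m≤n = ℕP.^-monoˡ-≤ q (s≤s m≤n)

    A-dec : ∀ {m n} → m ℕ.≤ n → A n ≤ A m
    A-dec {m} {n} m≤n = ^-cancel q (<⇒≤ (A-pos m)) (subst₂ _≤_ (sym (A^q n)) (sym (A^q m))
      (subst (λ l → c l ≤ c (k m)) (ℕP.m∸n+n≡m (k-mono m≤n)) (c-mono (k m) (k n ℕ.∸ k m))))

    A-lower : ∀ {m n} → m ℕ.≤ n → A m * (κ m * V₁ m) ≤ A n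
    A-lower {m} {n} m≤n = ^-cancel q (<⇒≤ (A-pos n)) (≤-trans (lower^q m)
      (≤-trans (subst (λ l → e (k m) ≤ e l) (ℕP.m∸n+n≡m (k-mono m≤n)) (e-mono (k m) (k n ℕ.∸ k m)))
        (≤-trans (e≤c n) (≤-reflexive (sym (A^q n))))))

    A-rate : ∀ {m n} → m ℕ.≤ n → ∣ A m - A n ∣ * fromℕ (suc m) ≤ A 0
    A-rate {m} {n} m≤n = ≤-trans (*-mono (fromℕ-nonNeg (suc m)) (*-nonNeg (<⇒≤ (A-pos m)) (<⇒≤ (0<V₁ m)))
        (≤-trans (≤-reflexive (0≤p⇒∣p∣≡p (≤⇒diff (A-dec m≤n)))) diff)
        (fromℕ-mono (ℕP.≤-trans suc≤k (ℕP.n≤1+n (k m)))))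
      (≤-trans (≤-reflexive eq) (A-dec z≤n))
      where
      suc≤k : suc m ℕ.≤ k m
      suc≤k = subst (ℕ._≤ k m) (ℕP.^-identityʳ (suc m)) (ℕP.^-monoʳ-≤ (suc m) (ℕ.>-nonZero⁻¹ q))
      diff : A m - A n ≤ A m * V₁ m
      diff = ≤-trans (+-monoʳ-≤ (A m) (neg-antimono-≤ (A-lower m≤n))) (≤-reflexive
        (trans (cong (_- A m * (κ m * V₁ m)) (trans (sym (*-identityʳ (A m))) (cong (A m *_) (sym (κV₁+V₁ m)))))
          (solve 3 (λ a s t → a :* (s :+ t) :- a :* s := a :* t) refl (A m) (κ m * V₁ m) (V₁ m))))
      eq : A m * V₁ m * fromℕ (suc (k m)) ≡ A m
      eq = trans (*-assoc (A m) (V₁ m) _) (trans (cong (A m *_) (trans (*-comm (V₁ m) _) (⁻¹-inv⁺ (fromℕ-pos (k m))))) (*-identityʳ (A m)))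

    good : Good A
    good = rate⇒cauchy (<⇒≤ (A-pos 0)) A-rate ,
      A 0 * (κ 0 * V₁ 0) , *-pos (A-pos 0) (0<κV₁ 0) , 0 , λ {n} _ →
        ≤-trans (A-lower z≤n) (≤-reflexive (sym (0≤p⇒∣p∣≡p (<⇒≤ (A-pos n)))))

  module Shift (y : F) (0<y : 0# < y) (p q : ℕ) .{{_ : ℕ.NonZero q}} where

    open +-*-Solver

    k : ℕ → ℕ
    k n = suc n ℕ.^ q

    κ i : ℕ → F
    κ n = fromℕ (k n)
    i n = (y + κ n) ⁻¹

    0<κ : ∀ n → 0# < κ n
    0<κ n = fromℕ-pos′ (k n) {{ℕP.m^n≢0 (suc n) q}}

    0<y+κ : ∀ n → 0# < y + κ n
    0<y+κ n = +-pos 0<y (<⇒≤ (0<κ n))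

    0<i : ∀ n → 0# < i n
    0<i n = ⁻¹-pos (0<y+κ n)

    rising-shift : ∀ j → rising (y + 1#) j * y ≡ rising y j * (y + fromℕ j)
    rising-shift zero    = solve 1 (λ y → con 1ℤ :* y := con 1ℤ :* (y :+ con 0ℤ)) refl y
    rising-shift (suc j) = trans
      (solve 3 (λ R y f → R :* (y :+ con 1ℤ :+ f) :* y := R :* y :* (y :+ (con 1ℤ :+ f))) refl (rising (y + 1#) j) y (fromℕ j))
      (cong₂ (λ s t → s * (y + t)) (rising-shift j) (sym (fromℕ-suc j)))

    rising⁻¹ : ∀ n → rising (y + 1#) (k n) ⁻¹ ≡ rising y (k n) ⁻¹ * (y * i n)
    rising⁻¹ n = ⁻¹-unique (rising-pos (k n) (+-pos 0<y (<⇒≤ 0<1)))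
      (trans (solve 4 (λ R S y i → R :* (S :* (y :* i)) := R :* y :* (S :* i)) refl (rising (y + 1#) (k n)) (rising y (k n) ⁻¹) y (i n))
      (trans (cong (_* (rising y (k n) ⁻¹ * i n)) (rising-shift (k n)))
      (trans (solve 4 (λ R Z S i → R :* Z :* (S :* i) := (R :* S) :* (Z :* i)) refl (rising y (k n)) (y + κ n) (rising y (k n) ⁻¹) (i n))
        (*≡1 (⁻¹-inv⁺ (rising-pos (k n) 0<y)) (⁻¹-inv⁺ (0<y+κ n))))))

    u : ℕ → F
    u n = y * (κ n * i n)

    euler-shift : ∀ n → euler y p q n * u n ≡ euler (y + 1#) (q ℕ.+ p) q n
    euler-shift n = sym (trans
      (cong₂ (λ s t → fromℕ (k n !) * s * (t * (ρ ^ q) ⁻¹)) (rising⁻¹ n)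
        (trans (^-homo-* ρ q p) (cong (_* ρ ^ p) (sym (fromℕ-^ (suc n) q)))))
      (solve 7 (λ f R y i κ P Q → f :* (R :* (y :* i)) :* (κ :* P :* Q) := f :* R :* (P :* Q) :* (y :* (κ :* i))) refl
        (fromℕ (k n !)) (rising y (k n) ⁻¹) y (i n) (κ n) (ρ ^ p) ((ρ ^ q) ⁻¹)))
      where ρ = fromℕ (suc n)

    i-cauchy : Cauchy i
    i-cauchy = null⇒cauchy (<⇒≤ 0<1) λ n →
      subst₂ _≤_ (cong (_* fromℕ (suc n)) (sym (0≤p⇒∣p∣≡p (<⇒≤ (0<i n))))) (trans (*-comm (i n) _) (⁻¹-inv⁺ (0<y+κ n)))
        (*-monoˡ (<⇒≤ (0<i n)) (≤-trans (fromℕ-mono (suc≤k n))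
          (subst (_≤ y + κ n) (+-identityˡ (κ n)) (+-monoˡ-≤ (κ n) (<⇒≤ 0<y)))))
      where
      suc≤k : ∀ m → suc m ℕ.≤ k m
      suc≤k m = subst (ℕ._≤ k m) (ℕP.^-identityʳ (suc m)) (ℕP.^-monoʳ-≤ (suc m) (ℕ.>-nonZero⁻¹ q))

    u≡ : ∀ n → y + (- (y * y)) * i n ≡ u n
    u≡ n = trans (cong (λ t → t + (- (y * y)) * i n) (trans (sym (*-identityʳ y)) (cong (y *_) (sym (⁻¹-inv⁺ (0<y+κ n))))))
      (solve 3 (λ y κ i → y :* ((y :+ κ) :* i) :+ (:- (y :* y)) :* i := y :* (κ :* i)) refl y (κ n) (i n))

    δ : F
    δ = y * (y + 1#) ⁻¹

    0<y+1 : 0# < y + 1#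
    0<y+1 = +-pos 0<y (<⇒≤ 0<1)

    δ≤u : ∀ n → δ ≤ u n
    δ≤u n = *-monoˡ (<⇒≤ 0<y) (*-cancelʳ (*-pos 0<y+1 (0<y+κ n)) (subst₂ _≤_ (sym eq₁) (sym eq₂) le))
      where
      1≤κ : 1# ≤ κ n
      1≤κ = fromℕ-mono (ℕ.>-nonZero⁻¹ (k n) {{ℕP.m^n≢0 (suc n) q}})
      le : y + κ n ≤ κ n * (y + 1#)
      le = ≤-trans (+-monoˡ-≤ (κ n) (subst (_≤ κ n * y) (*-identityˡ y) (*-monoʳ (<⇒≤ 0<y) 1≤κ)))
        (≤-reflexive (solve 2 (λ κ y → κ :* y :+ κ := κ :* (y :+ con 1ℤ)) refl (κ n) y))
      eq₁ : (y + 1#) ⁻¹ * ((y + 1#) * (y + κ n)) ≡ y + κ n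
      eq₁ = trans (solve 3 (λ j s t → j :* (s :* t) := s :* j :* t) refl ((y + 1#) ⁻¹) (y + 1#) (y + κ n))
        (trans (cong (_* (y + κ n)) (⁻¹-inv⁺ 0<y+1)) (*-identityˡ _))
      eq₂ : κ n * i n * ((y + 1#) * (y + κ n)) ≡ κ n * (y + 1#)
      eq₂ = trans (solve 4 (λ κ i s t → κ :* i :* (s :* t) := κ :* s :* (t :* i)) refl (κ n) (i n) (y + 1#) (y + κ n))
        (trans (cong (κ n * (y + 1#) *_) (⁻¹-inv⁺ (0<y+κ n))) (*-identityʳ _))

    u-good : Good u
    u-good = proj₁ (good-cong u≡ (+-cauchy (const-cauchy y) (*-cauchy (const-cauchy (- (y * y))) i-cauchy) ,
                      δ , *-pos 0<y (⁻¹-pos 0<y+1) , 0 , λ {n} _ → subst (λ t → δ ≤ ∣ t ∣) (sym (u≡ n)) (h n))) ,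
             δ , *-pos 0<y (⁻¹-pos 0<y+1) , 0 , λ {n} _ → h n
      where
      h : ∀ n → δ ≤ ∣ u n ∣
      h n = ≤-trans (δ≤u n) (≤-reflexive (sym (0≤p⇒∣p∣≡p (<⇒≤ (*-pos 0<y (*-pos (0<κ n) (0<i n)))))))

    shift : Good (euler y p q) → Good (euler (y + 1#) (q ℕ.+ p) q)
    shift g = good-cong euler-shift (good-* g u-good)

  -- Induction on p in steps of q, with f bounding the recursion.
  euler-good : ∀ f {x} → 0# < x → ∀ p q → .{{ℕ.NonZero p}} → .{{ℕ.NonZero q}} → p ℕ.≤ f →
               x * fromℕ q ≡ fromℕ p → Good (euler x p q)
  euler-good zero {x} 0<x (suc _) q ()
  euler-good (suc f) {x} 0<x p q p≤f x≡ with p ℕP.≤? q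
  ... | yes p≤q = subst (λ q → Good (euler x p q)) (ℕP.m+[n∸m]≡n p≤q)
    (Base.good x 0<x p (q ℕ.∸ p) (trans (cong (λ q → x * fromℕ q) (ℕP.m+[n∸m]≡n p≤q)) x≡))
  ... | no p≰q = subst₂ (λ x p → Good (euler x p q)) y+1≡x q+r≡p
    (Shift.shift y 0<y r q (euler-good f 0<y r q {{r≢0}} r≤f y≡))
    where
    open +-*-Solver
    q<p = ℕP.≰⇒> p≰q
    r = p ℕ.∸ q
    y = x - 1#
    q+r≡p = ℕP.m+[n∸m]≡n (ℕP.<⇒≤ q<p)
    r≢0 : ℕ.NonZero r
    r≢0 = ℕ.>-nonZero (ℕP.m<n⇒0<n∸m q<p)
    r≤f : r ℕ.≤ f
    r≤f = ℕ.s≤s⁻¹ (ℕP.≤-trans (ℕP.∸-monoʳ-< (ℕ.>-nonZero⁻¹ q) (ℕP.<⇒≤ q<p)) p≤f)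
    y+1≡x : y + 1# ≡ x
    y+1≡x = solve 1 (λ x → x :- con 1ℤ :+ con 1ℤ := x) refl x
    y≡ : y * fromℕ q ≡ fromℕ r
    y≡ = trans (solve 2 (λ x q → (x :- con 1ℤ) :* q := x :* q :- q) refl x (fromℕ q))
      (trans (cong (_- fromℕ q) (trans x≡ (trans (cong fromℕ (sym q+r≡p)) (fromℕ-+ q r))))
        (solve 2 (λ q r → q :+ r :- q := r) refl (fromℕ q) (fromℕ r)))
    0<y : 0# < y
    0<y = *-cancelʳ-< (fromℕ-nonNeg q)
      (subst₂ _<_ (sym (*-zeroˡ (fromℕ q))) (sym y≡) (fromℕ-pos′ r {{r≢0}}))

open import Data.Rational.Base
open import Data.Rational.Properties
open import Data.Rational.Unnormalised.Base using (mkℚᵘ) renaming (*≡* to *≡*ᵘ)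

open Exp (CommutativeRing.commutativeSemiring +-*-commutativeRing) using (_^_)

fromℕ : ℕ → ℚ
fromℕ n = + n / 1

infix 9 _⁻¹

-- Total reciprocal, with 0 ⁻¹ = 0.
_⁻¹ : ℚ → ℚ
q ⁻¹ with q ≟ 0ℚ
... | yes _   = 0ℚ
... | no  q≢0 = (1/ q) {{≢-nonZero q≢0}}

⟦_⟧ : ℤ → ℚ
⟦ m ⟧ = m / 1

coprime-1 : ∀ n → Coprimality.Coprime n 1
coprime-1 n = Coprimality.sym (Coprimality.1-coprimeTo n)

⟦⟧-mk : ∀ m → ⟦ m ⟧ ≡ mkℚ m 0 (coprime-1 ℤ.∣ m ∣)
⟦⟧-mk m = ↥p/↧p≡p (mkℚ m 0 (coprime-1 ℤ.∣ m ∣))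

+-homo : ∀ m n → ⟦ m ℤ.+ n ⟧ ≡ ⟦ m ⟧ + ⟦ n ⟧
+-homo m n rewrite ⟦⟧-mk m | ⟦⟧-mk n
  = cong ⟦_⟧ (cong₂ ℤ._+_ (sym (ℤP.*-identityʳ m)) (sym (ℤP.*-identityʳ n)))

*-homo : ∀ m n → ⟦ m ℤ.* n ⟧ ≡ ⟦ m ⟧ * ⟦ n ⟧
*-homo m n rewrite ⟦⟧-mk m | ⟦⟧-mk n = refl

-‿homo : ∀ m → ⟦ ℤ.- m ⟧ ≡ - ⟦ m ⟧
-‿homo +0       = refl
-‿homo +[1+ n ] = refl
-‿homo -[1+ n ] rewrite ⟦⟧-mk +[1+ n ] = refl

⁻¹-inverse : ∀ {q} → q ≢ 0ℚ → q * q ⁻¹ ≡ 1ℚ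
⁻¹-inverse {q} q≢0 with q ≟ 0ℚ
... | yes q≡0  = contradiction q≡0 q≢0
... | no  q≢0′ = *-inverseʳ q {{≢-nonZero q≢0′}}

↥≡*↧ : ∀ {x} → 0ℚ < x → x * fromℕ (↧ₙ x) ≡ fromℕ ℤ.∣ ↥ x ∣
↥≡*↧ {x@(mkℚ +[1+ a ] d c)} _ rewrite ⟦⟧-mk (+ suc d) =
  fromℚᵘ-cong {mkℚᵘ (+[1+ a ] ℤ.* + suc d) (d ℕ.* 1)} {mkℚᵘ +[1+ a ] 0}
    (*≡*ᵘ (trans (ℤP.*-identityʳ _) (cong (λ e → +[1+ a ] ℤ.* + suc e) (sym (ℕP.*-identityʳ d)))))
↥≡*↧ {mkℚ +0 d c}       (*<* (ℤ.+<+ ()))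
↥≡*↧ {mkℚ -[1+ a ] d c} (*<* ())

↥-pos : ∀ {x} → 0ℚ < x → ℕ.NonZero ℤ.∣ ↥ x ∣
↥-pos {mkℚ +[1+ a ] d c} _ = _
↥-pos {mkℚ +0 d c}       (*<* (ℤ.+<+ ()))
↥-pos {mkℚ -[1+ a ] d c} (*<* ())

fromℕ≥1 : ∀ n → .{{ℕ.NonZero n}} → 1ℚ ≤ fromℕ n
fromℕ≥1 (suc n) = subst (1ℚ ≤_) (sym (+-homo 1ℤ (+ n)))
  (subst (_≤ 1ℚ + fromℕ n) (+-identityʳ 1ℚ) (+-monoʳ-≤ 1ℚ (nonNegative⁻¹ (fromℕ n) {{normalize-nonNeg n 1}})))

archimedean : ∀ {ε} → 0ℚ < ε → ∃[ N ] 1ℚ ≤ ε * fromℕ (suc N)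
archimedean {ε} 0<ε = ℕ.pred (↧ₙ ε) , subst (1ℚ ≤_) (sym (↥≡*↧ 0<ε))
  (fromℕ≥1 _ {{↥-pos 0<ε}})

ℚ-orderedField : OrderedField
ℚ-orderedField = record
  { F = ℚ ; _+_ = _+_ ; _*_ = _*_ ; -_ = -_ ; ∣_∣ = ∣_∣ ; _⁻¹ = _⁻¹ ; _≤_ = _≤_ ; _<_ = _<_ ; ⟦_⟧ = ⟦_⟧ ; ½ = ½
  ; isCommutativeRing = +-*-isCommutativeRing
  ; +-homo = +-homo ; *-homo = *-homo ; -‿homo = -‿homo
  ; ½+½≡1 = refl
  ; ⁻¹-inverse = ⁻¹-inverse
  ; ≤-reflexive = ≤-reflexive ; ≤-trans = ≤-trans ; ≤-antisym = ≤-antisym ; ≤-total = ≤-total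
  ; <-irrefl = <-irrefl ; <⇒≤ = <⇒≤ ; ≮⇒≥ = ≮⇒≥ ; ≰⇒> = ≰⇒> ; <-≤-trans = <-≤-trans ; ≤-<-trans = ≤-<-trans
  ; +-mono-≤ = +-mono-≤ ; +-mono-<-≤ = +-mono-<-≤ ; neg-antimono-≤ = neg-antimono-≤
  ; *-monoˡ = λ {r} 0≤r → *-monoˡ-≤-nonNeg r {{nonNegative 0≤r}}
  ; *-monoʳ-< = λ {r} 0<r → *-monoˡ-<-pos r {{positive 0<r}}
  ; 0<1 = positive⁻¹ 1ℚ ; 0<½ = positive⁻¹ ½
  ; 0≤∣p∣ = 0≤∣p∣ ; 0≤p⇒∣p∣≡p = 0≤p⇒∣p∣≡p ; ∣-p∣≡∣p∣ = ∣-p∣≡∣p∣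
  ; ∣p+q∣≤∣p∣+∣q∣ = ∣p+q∣≤∣p∣+∣q∣ ; ∣p*q∣≡∣p∣*∣q∣ = ∣p*q∣≡∣p∣*∣q∣
  ; archimedean = archimedean
  }

module Conv = Convergence ℚ-orderedField

Cauchy : (ℕ → ℚ) → Set
Cauchy a = ∀ {ε} → 0ℚ < ε → ∃[ N ] ∀ {m n} → N ℕ.≤ m → N ℕ.≤ n → ∣ a m - a n ∣ < ε

record ℝ : Set where
  no-eta-equality
  field
    approx : ℕ → ℚ
    cauchy : Cauchy approx

open ℝ public

infix 4 _≈ℝ_

_≈ℝ_ : ℝ → ℝ → Set
x ≈ℝ y = ∀ {ε} → 0ℚ < ε → ∃[ N ] ∀ {n} → N ℕ.≤ n → ∣ approx x n - approx y n ∣ < ε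

Apart0 : (ℕ → ℚ) → Set
Apart0 a = ∃[ δ ] 0ℚ < δ × (∃[ N ] ∀ {n} → N ℕ.≤ n → δ ≤ ∣ a n ∣)

-- Apartness from zero, i.e. constructive invertibility.
record NonZeroℝ (x : ℝ) : Set where
  constructor mkNonZeroℝ
  field apart0 : Apart0 (approx x)

open NonZeroℝ public

infixl 6 _+ℝ_
infixl 7 _*ℝ_ _÷ℝ_
infixr 8 _^ℝ_

_+ℝ_ : ℝ → ℝ → ℝ
approx (x +ℝ y) n = approx x n + approx y n
cauchy (x +ℝ y) = Conv.+-cauchy {approx x} {approx y} (cauchy x) (cauchy y)

_*ℝ_ : ℝ → ℝ → ℝ
approx (x *ℝ y) n = approx x n * approx y n
cauchy (x *ℝ y) = Conv.*-cauchy {approx x} {approx y} (cauchy x) (cauchy y)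

^-cauchy : ∀ {a} k → Cauchy a → Cauchy (λ n → a n ^ k)
^-cauchy     zero    ca = Conv.const-cauchy 1ℚ
^-cauchy {a} (suc k) ca = Conv.*-cauchy {a} {λ n → a n ^ k} ca (^-cauchy {a} k ca)

^-apart0 : ∀ {a} k → Apart0 a → Apart0 (λ n → a n ^ k)
^-apart0     zero    ha = Conv.const-apart0 {1ℚ} (positive⁻¹ 1ℚ)
^-apart0 {a} (suc k) ha = Conv.*-apart0 {a} {λ n → a n ^ k} ha (^-apart0 {a} k ha)

_^ℝ_ : ℝ → ℕ → ℝ
approx (x ^ℝ k) n = approx x n ^ k
cauchy (x ^ℝ k) = ^-cauchy {approx x} k (cauchy x)

_÷ℝ_ : (x y : ℝ) → {{NonZeroℝ y}} → ℝ
approx (x ÷ℝ y) n = approx x n * approx y n ⁻¹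
cauchy ((x ÷ℝ y) {{y#0}}) = Conv.*-cauchy {approx x} {λ n → approx y n ⁻¹} (cauchy x)
  (Conv.⁻¹-cauchy {approx y} (apart0 y#0) (cauchy y))

rising : ℚ → ℕ → ℚ
rising x zero    = 1ℚ
rising x (suc k) = rising x k * (x + fromℕ k)

-- k! k^(x-1) / (x)ₖ with x = p/q and k = rᵠ, r = n + 1, so that k^(x-1) = rᵖ / rᵠ.
euler : ℚ → (p q : ℕ) → ℕ → ℚ
euler x p q n = fromℕ (k !) * rising x k ⁻¹ * (fromℕ r ^ p * (fromℕ r ^ q) ⁻¹)
  where
  r = suc n
  k = r ℕ.^ q

rising≡ : ∀ x k → Conv.rising x k ≡ rising x k
rising≡ x zero    = refl
rising≡ x (suc k) = cong (_* (x + fromℕ k)) (rising≡ x k)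

^≡ : ∀ a n → a Conv.^ n ≡ a ^ n
^≡ a zero    = refl
^≡ a (suc n) = cong (a *_) (^≡ a n)

euler≡ : ∀ x p q n → Conv.euler x p q n ≡ euler x p q n
euler≡ x p q n = cong₂ _*_
  (cong (λ t → fromℕ (k !) * t ⁻¹) (rising≡ x k))
  (cong₂ (λ s t → s * t ⁻¹) (^≡ (fromℕ (suc n)) p) (^≡ (fromℕ (suc n)) q))
  where k = suc n ℕ.^ q

Γ-good : ∀ {x} → 0ℚ < x → Conv.Good (euler x ℤ.∣ ↥ x ∣ (↧ₙ x))
Γ-good {x@record{}} 0<x = Conv.good-cong {Conv.euler x p q} {euler x p q} (euler≡ x p q)
  (Conv.euler-good p {x} 0<x p q {{↥-pos 0<x}} ℕP.≤-refl (↥≡*↧ 0<x))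
  where
  p = ℤ.∣ ↥ x ∣
  q = ↧ₙ x

-- Euler's limit Γ(x) = lim k! k^(x-1) / (x)ₖ for rational x = p/q > 0,
-- taken along the q-th powers k = rᵠ, where the terms are rational.
Γ : (x : ℚ) → 0ℚ < x → ℝ
approx (Γ x 0<x) = euler x ℤ.∣ ↥ x ∣ (↧ₙ x)
cauchy (Γ x 0<x) = proj₁ (Γ-good 0<x)

-1<⇒0< : ∀ {x} → - 1ℚ < x → 0ℚ < x + 1ℚ
-1<⇒0< -1<x = +-monoˡ-< 1ℚ -1<x

factorial : (x : ℚ) → - 1ℚ < x → ℝ
factorial x -1<x = Γ (x + 1ℚ) (-1<⇒0< -1<x)

-1<n+3/2 : ∀ n → - 1ℚ < fromℕ n + + 3 / 2
-1<n+3/2 n = <-trans (negative⁻¹ (- 1ℚ))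
  (<-respʳ-≡ (+-comm (+ 3 / 2) (fromℕ n)) (Conv.+-pos (positive⁻¹ (+ 3 / 2)) (Conv.fromℕ-nonNeg n)))

[_+3/2]! : ℕ → ℝ
[ n +3/2]! = factorial (fromℕ n + + 3 / 2) (-1<n+3/2 n)

ℕ→ℝ : ℕ → ℝ
approx (ℕ→ℝ n) _ = fromℕ n
cauchy (ℕ→ℝ n) = Conv.const-cauchy (fromℕ n)

infix 9 _!ℝ _choose_

_!ℝ : ℕ → ℝ
approx (n !ℝ) _ = fromℕ (n !)
cauchy (n !ℝ) = Conv.const-cauchy (fromℕ (n !))

-- Restricted to k < n, where the coefficient is invertible.
_choose_ : (n : ℕ) → Fin n → ℝ
approx (n choose k) _ = fromℕ (n C toℕ k)
cauchy (n choose k) = Conv.const-cauchy (fromℕ (n C toℕ k))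

nCk≢0 : ∀ {n k} → k ℕ.≤ n → ℕ.NonZero (n C k)
nCk≢0 {n} {k} k≤n = subst ℕ.NonZero (sym (nCk≡n!/k![n-k]! k≤n))
  (ℕ.>-nonZero (m≥n⇒m/n>0 {{k ℕP.!* (n ℕ.∸ k) !≢0}} (∣⇒≤ {{n ℕP.!≢0}} (k![n∸k]!∣n! k≤n))))

∑ : (n : ℕ) → (Fin n → ℝ) → ℝ
∑ zero    f = ℕ→ℝ 0
∑ (suc n) f = f Fin.zero +ℝ ∑ n (λ i → f (Fin.suc i))

syntax ∑ n (λ k → t) = ∑[ k < n ] t

instance
  ℕ→ℝ-nonZero : ∀ {n} → NonZeroℝ (ℕ→ℝ (suc n))
  ℕ→ℝ-nonZero {n} = mkNonZeroℝ (Conv.const-apart0 {fromℕ (suc n)} (Conv.fromℕ-pos n))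

  !ℝ-nonZero : ∀ {n} → NonZeroℝ (n !ℝ)
  !ℝ-nonZero {n} = mkNonZeroℝ (Conv.const-apart0 {fromℕ (n !)} (Conv.fromℕ-pos′ (n !) {{n ℕP.!≢0}}))

  choose-nonZero : ∀ {n} {k : Fin n} → NonZeroℝ (n choose k)
  choose-nonZero {n} {k} =
    mkNonZeroℝ (Conv.const-apart0 {fromℕ (n C toℕ k)} (Conv.fromℕ-pos′ (n C toℕ k) {{nCk≢0 (ℕP.<⇒≤ (toℕ<n k))}}))

  *ℝ-nonZero : ∀ {x y} → {{NonZeroℝ x}} → {{NonZeroℝ y}} → NonZeroℝ (x *ℝ y)
  *ℝ-nonZero {x} {y} {{x#0}} {{y#0}} = mkNonZeroℝ (Conv.*-apart0 {approx x} {approx y} (apart0 x#0) (apart0 y#0))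

  ^ℝ-nonZero : ∀ {x k} → {{NonZeroℝ x}} → NonZeroℝ (x ^ℝ k)
  ^ℝ-nonZero {x} {k} {{x#0}} = mkNonZeroℝ (^-apart0 {approx x} k (apart0 x#0))

  Γ-nonZero : ∀ {x 0<x} → NonZeroℝ (Γ x 0<x)
  Γ-nonZero {0<x = 0<x} = mkNonZeroℝ (proj₂ (Γ-good 0<x))

{-# OPTIONS --safe #-}

-- Write S(n) for the left-hand side, F(n,k) = C(n,k)⁻² and P for the cubic on the right.
-- Zeilberger's algorithm yields the certificate r(k) = 2k − 3(n+2):
--   2(2n+5)(n+1)² F(n+1,k) − (n+2)³ F(n,k) = (n+1)² (r(k+1) F(n+1,k+1) − r(k) F(n+1,k)),
-- and summing over 0 ≤ k ≤ n gives
--   2(2n+5)(n+1)² S(n+1) = (n+2)³ S(n) + P(n),   P(n) = (n+2)³ + 2(n+1)³.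
-- The m-th rational approximation R(n,m) of the right-hand side satisfies the same recurrence with
-- y = n + 5/2 replaced by the ratio u of the Euler approximations of Γ(y+1) and Γ(y); since
-- 1/u = 1/y + 1/(m+1)², induction on n shows S(n) − R(n,m) = O(1/m).
module Submission where

open import Defs using (OrderedField; module Convergence; nCk≢0)
open import Algebra.Structures using (IsCommutativeRing)
open import Data.Integer.Base as ℤ using (+_; 0ℤ; 1ℤ)
open import Data.Nat.Base as ℕ using (ℕ; zero; suc; _!; z≤n; s≤s)
open import Data.Nat.Combinatorics using (_C_; nCk≡n!/k![n-k]!; k![n∸k]!∣n!; nCk≡nC[n∸k]; nCn≡1)
open import Data.Nat.DivMod using (m/n*n≡m)
import Data.Nat.Properties as ℕP
import Data.Nat.Solver as ℕSolver
open import Data.Product.Base using (∃-syntax; _×_; _,_; proj₁; proj₂)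
open import Function.Base using (_∘_)
open import Relation.Binary.PropositionalEquality using (_≡_; refl; sym; trans; cong; cong₂; subst; subst₂; module ≡-Reasoning)

-- Absorption identities for binomial coefficients.

nC0≡1 : ∀ n → n C 0 ≡ 1
nC0≡1 n = trans (nCk≡nC[n∸k] {n = n} z≤n) (nCn≡1 n)

nCk*k![n∸k]!≡n! : ∀ {n k} → k ℕ.≤ n → (n C k) ℕ.* (k ! ℕ.* (n ℕ.∸ k) !) ≡ n !
nCk*k![n∸k]!≡n! {n} {k} k≤n =
  trans (cong (ℕ._* (k ! ℕ.* (n ℕ.∸ k) !)) (nCk≡n!/k![n-k]! k≤n))
    (m/n*n≡m {{k ℕP.!* (n ℕ.∸ k) !≢0}} (k![n∸k]!∣n! k≤n))

-- Multiplied by k! (n - k)!, both sides become (n + 1)!, and this factor can be cancelled.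
[1+k]*[1+n]C[1+k]≡[1+n]*nCk : ∀ {n k} → k ℕ.≤ n → suc k ℕ.* (suc n C suc k) ≡ suc n ℕ.* (n C k)
[1+k]*[1+n]C[1+k]≡[1+n]*nCk {n} {k} k≤n = ℕP.*-cancelʳ-≡ _ _ (a ℕ.* b) {{k ℕP.!* (n ℕ.∸ k) !≢0}} (begin
  suc k ℕ.* (suc n C suc k) ℕ.* (a ℕ.* b)
    ≡⟨ solve 4 (λ s c a b → s :* c :* (a :* b) := c :* (s :* a :* b)) refl (suc k) (suc n C suc k) a b ⟩
  (suc n C suc k) ℕ.* (suc k ! ℕ.* b)
    ≡⟨ nCk*k![n∸k]!≡n! (s≤s k≤n) ⟩
  suc n ℕ.* n !
    ≡⟨ cong (suc n ℕ.*_) (sym (nCk*k![n∸k]!≡n! k≤n)) ⟩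
  suc n ℕ.* ((n C k) ℕ.* (a ℕ.* b))
    ≡⟨ sym (ℕP.*-assoc (suc n) (n C k) (a ℕ.* b)) ⟩
  suc n ℕ.* (n C k) ℕ.* (a ℕ.* b) ∎)
  where
  open ≡-Reasoning
  open ℕSolver.+-*-Solver
  a = k !
  b = (n ℕ.∸ k) !

-- The previous identity at n - k, carried over by the symmetry of the binomial coefficients.
[1+n∸k]*[1+n]Ck≡[1+n]*nCk : ∀ {n k} → k ℕ.≤ n → suc (n ℕ.∸ k) ℕ.* (suc n C k) ≡ suc n ℕ.* (n C k)
[1+n∸k]*[1+n]Ck≡[1+n]*nCk {n} {k} k≤n = begin
  suc (n ℕ.∸ k) ℕ.* (suc n C k)
    ≡⟨ cong (suc (n ℕ.∸ k) ℕ.*_) (nCk≡nC[n∸k] (ℕP.m≤n⇒m≤1+n k≤n)) ⟩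
  suc (n ℕ.∸ k) ℕ.* (suc n C (suc n ℕ.∸ k))
    ≡⟨ cong (λ l → suc (n ℕ.∸ k) ℕ.* (suc n C l)) (ℕP.+-∸-assoc 1 k≤n) ⟩
  suc (n ℕ.∸ k) ℕ.* (suc n C suc (n ℕ.∸ k))
    ≡⟨ [1+k]*[1+n]C[1+k]≡[1+n]*nCk (ℕP.m∸n≤m n k) ⟩
  suc n ℕ.* (n C (n ℕ.∸ k))
    ≡⟨ cong (suc n ℕ.*_) (sym (nCk≡nC[n∸k] k≤n)) ⟩
  suc n ℕ.* (n C k) ∎
  where open ≡-Reasoning

cubic : ℕ → ℕ
cubic n = 3 ℕ.* n ℕ.^ 3 ℕ.+ 12 ℕ.* n ℕ.^ 2 ℕ.+ 18 ℕ.* n ℕ.+ 10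

-- The right-hand form is what the boundary terms of the telescoped sum produce in `S-rec`.
cubic≡ : ∀ n → cubic n ≡ (2 ℕ.+ n) ℕ.^ 3 ℕ.+ 2 ℕ.* (1 ℕ.+ n) ℕ.^ 3
cubic≡ = solve 1 (λ n → con 3 :* n :^ 3 :+ con 12 :* n :^ 2 :+ con 18 :* n :+ con 10
                     := (con 2 :+ n) :^ 3 :+ con 2 :* (con 1 :+ n) :^ 3) refl
  where open ℕSolver.+-*-Solver

module Identity (𝔽 : OrderedField) where

  open OrderedField 𝔽
  open Convergence 𝔽
  open IsCommutativeRing isCommutativeRing
    using (+-identityˡ; +-identityʳ; +-assoc; *-identityˡ; *-identityʳ; *-assoc; *-comm; distribʳ; zeroʳ)
  open +-*-Solver using (solve; _:=_; _:+_; _:*_; _:-_; :-_; con)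
  open ≡-Reasoning

  *-cancelˡ-≡ : ∀ {r p q} → 0# < r → r * p ≡ r * q → p ≡ q
  *-cancelˡ-≡ {r} {p} {q} 0<r eq = ≤-antisym
    (*-cancelʳ 0<r (≤-reflexive eq′)) (*-cancelʳ 0<r (≤-reflexive (sym eq′)))
    where eq′ = trans (*-comm p r) (trans eq (*-comm r q))

  -- Finite sums and reciprocal squares of binomial coefficients.

  sum : (ℕ → F) → ℕ → F
  sum f zero    = 0#
  sum f (suc n) = sum f n + f n

  -- Reconciles `sum`, which grows at the end as the recurrences need, with the sum over `Fin`,
  -- which grows at the front.
  sum-head : ∀ f n → sum f (suc n) ≡ f 0 + sum (f ∘ suc) n
  sum-head f zero    = trans (+-identityˡ (f 0)) (sym (+-identityʳ (f 0)))
  sum-head f (suc n) = trans (cong (_+ f (suc n)) (sum-head f n)) (+-assoc (f 0) _ _)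

  F[_,_] : ℕ → ℕ → F
  F[ n , k ] = (fromℕ (n C k) ^ 2) ⁻¹

  S : ℕ → F
  S n = sum F[ n ,_] n

  F≡1 : ∀ n k → n C k ≡ 1 → F[ n , k ] ≡ 1#
  F≡1 n k eq = trans (cong (λ c → (fromℕ c ^ 2) ⁻¹) eq)
    (⁻¹-unique (^-pos 2 0<1) (trans (*-identityʳ _) (1^ 2)))

  -- Square the proportion and divide by a²b². It is applied with a and b adjacent binomial
  -- coefficients, turning absorption into a relation between values of F.
  square⁻¹-ratio : ∀ {N L a b} → 0# < a → 0# < b → L * b ≡ N * a →
                   N * N * (b ^ 2) ⁻¹ ≡ L * L * (a ^ 2) ⁻¹
  square⁻¹-ratio {N} {L} {a} {b} 0<a 0<b eq = begin
    N * N * B                      ≡⟨ sym (*-identityʳ _) ⟩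
    N * N * B * 1#                 ≡⟨ cong (N * N * B *_) (sym (⁻¹-inv⁺ (^-pos 2 0<a))) ⟩
    N * N * B * (a ^ 2 * A)
      ≡⟨ solve 4 (λ N B a A → N :* N :* B :* (a :* (a :* con 1ℤ) :* A) := (N :* a) :* (N :* a) :* (A :* B)) refl N B a A ⟩
    (N * a) * (N * a) * (A * B)    ≡⟨ cong (λ t → t * t * (A * B)) (sym eq) ⟩
    (L * b) * (L * b) * (A * B)
      ≡⟨ solve 4 (λ L B b A → (L :* b) :* (L :* b) :* (A :* B) := L :* L :* A :* (b :* (b :* con 1ℤ) :* B)) refl L B b A ⟩
    L * L * A * (b ^ 2 * B)        ≡⟨ cong (L * L * A *_) (⁻¹-inv⁺ (^-pos 2 0<b)) ⟩
    L * L * A * 1#                 ≡⟨ *-identityʳ _ ⟩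
    L * L * A ∎
    where
    A = (a ^ 2) ⁻¹
    B = (b ^ 2) ⁻¹

  fromℕ-C-pos : ∀ {n k} → k ℕ.≤ n → 0# < fromℕ (n C k)
  fromℕ-C-pos {n} {k} k≤n = fromℕ-pos′ (n C k) {{nCk≢0 k≤n}}

  fromℕ-*-cong : ∀ {a b c d} → a ℕ.* b ≡ c ℕ.* d → fromℕ a * fromℕ b ≡ fromℕ c * fromℕ d
  fromℕ-*-cong {a} {b} {c} {d} eq = trans (sym (fromℕ-* a b)) (trans (cong fromℕ eq) (fromℕ-* c d))

  F-sucˡ : ∀ {n k} → k ℕ.≤ n → fromℕ (suc n) * fromℕ (suc n) * F[ suc n , k ]
                               ≡ fromℕ (suc (n ℕ.∸ k)) * fromℕ (suc (n ℕ.∸ k)) * F[ n , k ]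
  F-sucˡ {n} {k} k≤n = square⁻¹-ratio (fromℕ-C-pos k≤n) (fromℕ-C-pos (ℕP.m≤n⇒m≤1+n k≤n))
    (fromℕ-*-cong {suc (n ℕ.∸ k)} {suc n C k} {suc n} {n C k} ([1+n∸k]*[1+n]Ck≡[1+n]*nCk k≤n))

  F-suc : ∀ {n k} → k ℕ.≤ n → fromℕ (suc n) * fromℕ (suc n) * F[ suc n , suc k ]
                              ≡ fromℕ (suc k) * fromℕ (suc k) * F[ n , k ]
  F-suc {n} {k} k≤n = square⁻¹-ratio (fromℕ-C-pos k≤n) (fromℕ-C-pos (s≤s k≤n))
    (fromℕ-*-cong {suc k} {suc n C suc k} {suc n} {n C k} ([1+k]*[1+n]C[1+k]≡[1+n]*nCk k≤n))

  fromℕ-cubic : ∀ n → fromℕ (cubic n) ≡ fromℕ (2 ℕ.+ n) ^ 3 + ⟦ + 2 ⟧ * fromℕ (1 ℕ.+ n) ^ 3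
  fromℕ-cubic n = trans (cong fromℕ (cubic≡ n)) (trans (fromℕ-+ ((2 ℕ.+ n) ℕ.^ 3) _)
    (cong₂ _+_ (fromℕ-^ (2 ℕ.+ n) 3) (trans (fromℕ-* 2 _) (cong (⟦ + 2 ⟧ *_) (fromℕ-^ (1 ℕ.+ n) 3)))))

  -- Zeilberger recurrence for the left-hand side.

  module Recurrence (n : ℕ) where

    f N M α β : F
    f = fromℕ n
    N = fromℕ (1 ℕ.+ n)
    M = fromℕ (2 ℕ.+ n)
    α = (⟦ + 4 ⟧ * f + ⟦ + 10 ⟧) * (N * N)
    β = M ^ 3

    N≡ : N ≡ 1# + f
    N≡ = fromℕ-suc n

    M≡ : M ≡ 1# + (1# + f)
    M≡ = trans (fromℕ-suc (suc n)) (cong (λ t → 1# + t) N≡)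

    r h : ℕ → F
    r k = ⟦ + 2 ⟧ * fromℕ k - ⟦ + 3 ⟧ * M
    h k = r k * (N * N * F[ suc n , k ])

    -- By `F-sucˡ` and `F-suc` every term is a polynomial multiple of F(n,k), so only a polynomial
    -- identity in k and n - k remains. The negative terms of the certificate are moved across.
    certificate : ∀ {k} → k ℕ.≤ n → α * F[ suc n , k ] + h k ≡ β * F[ n , k ] + h (suc k)
    certificate {k} k≤n = begin
      α * F[ suc n , k ] + h k
        ≡⟨ solve 4 (λ a N F r → a :* (N :* N) :* F :+ r :* (N :* N :* F) := (a :+ r) :* (N :* N :* F)) refl
             (⟦ + 4 ⟧ * f + ⟦ + 10 ⟧) N F[ suc n , k ] (r k) ⟩
      (⟦ + 4 ⟧ * f + ⟦ + 10 ⟧ + r k) * (N * N * F[ suc n , k ])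
        ≡⟨ cong ((⟦ + 4 ⟧ * f + ⟦ + 10 ⟧ + r k) *_) (trans (F-sucˡ k≤n) (cong (λ t → t * t * F[ n , k ]) (fromℕ-suc l))) ⟩
      (⟦ + 4 ⟧ * f + ⟦ + 10 ⟧ + (⟦ + 2 ⟧ * κ - ⟦ + 3 ⟧ * M)) * ((1# + λ′) * (1# + λ′) * F[ n , k ])
        -- Writing n = k + l makes k and l = n - k independent indeterminates, free of truncated
        -- subtraction.
        ≡⟨ cong₂ (λ f M → (⟦ + 4 ⟧ * f + ⟦ + 10 ⟧ + (⟦ + 2 ⟧ * κ - ⟦ + 3 ⟧ * M)) * ((1# + λ′) * (1# + λ′) * F[ n , k ])) f≡ M≡′ ⟩
      (⟦ + 4 ⟧ * (κ + λ′) + ⟦ + 10 ⟧ + (⟦ + 2 ⟧ * κ - ⟦ + 3 ⟧ * (1# + (1# + (κ + λ′))))) * ((1# + λ′) * (1# + λ′) * F[ n , k ])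
        ≡⟨ solve 3 (λ κ l F →
             let M = con 1ℤ :+ (con 1ℤ :+ (κ :+ l)) in
             (con (+ 4) :* (κ :+ l) :+ con (+ 10) :+ (con (+ 2) :* κ :- con (+ 3) :* M)) :* ((con 1ℤ :+ l) :* (con 1ℤ :+ l) :* F)
             := (M :* (M :* (M :* con 1ℤ))) :* F :+ (con (+ 2) :* (con 1ℤ :+ κ) :- con (+ 3) :* M) :* ((con 1ℤ :+ κ) :* (con 1ℤ :+ κ) :* F))
             refl κ λ′ F[ n , k ] ⟩
      (1# + (1# + (κ + λ′))) ^ 3 * F[ n , k ]
        + (⟦ + 2 ⟧ * (1# + κ) - ⟦ + 3 ⟧ * (1# + (1# + (κ + λ′)))) * ((1# + κ) * (1# + κ) * F[ n , k ])
        ≡⟨ sym (cong₂ (λ M K → M ^ 3 * F[ n , k ] + (⟦ + 2 ⟧ * K - ⟦ + 3 ⟧ * M) * (K * K * F[ n , k ])) M≡′ (fromℕ-suc k)) ⟩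
      β * F[ n , k ] + r (suc k) * (fromℕ (suc k) * fromℕ (suc k) * F[ n , k ])
        ≡⟨ cong (λ t → β * F[ n , k ] + r (suc k) * t) (sym (F-suc k≤n)) ⟩
      β * F[ n , k ] + h (suc k) ∎
      where
      l = n ℕ.∸ k
      κ = fromℕ k
      λ′ = fromℕ l
      f≡ : f ≡ κ + λ′
      f≡ = trans (cong fromℕ (sym (ℕP.m+[n∸m]≡n k≤n))) (fromℕ-+ k l)
      M≡′ : M ≡ 1# + (1# + (κ + λ′))
      M≡′ = trans M≡ (cong (λ t → 1# + (1# + t)) f≡)

    -- The range reaches j = n + 1 because the certificate also holds at k = n, the last index of
    -- S(n + 1).
    telescope : ∀ j → j ℕ.≤ suc n → α * sum F[ suc n ,_] j + h 0 ≡ β * sum F[ n ,_] j + h j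
    telescope zero    _  = cong (_+ h 0) (trans (zeroʳ α) (sym (zeroʳ β)))
    telescope (suc j) (s≤s j≤n) = begin
      α * (s₁ + F₁) + h 0
        ≡⟨ solve 5 (λ α s F h h₀ → α :* (s :+ F) :+ h₀ := (α :* s :+ h₀) :+ (α :* F :+ h) :- h) refl α s₁ F₁ (h j) (h 0) ⟩
      (α * s₁ + h 0) + (α * F₁ + h j) - h j
        ≡⟨ cong₂ (λ s t → s + t - h j) (telescope j (ℕP.m≤n⇒m≤1+n j≤n)) (certificate j≤n) ⟩
      (β * s₀ + h j) + (β * F₀ + h (suc j)) - h j
        ≡⟨ solve 5 (λ β s F h h₁ → (β :* s :+ h) :+ (β :* F :+ h₁) :- h := β :* (s :+ F) :+ h₁) refl β s₀ F₀ (h j) (h (suc j)) ⟩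
      β * (s₀ + F₀) + h (suc j) ∎
      where
      s₁ = sum F[ suc n ,_] j
      s₀ = sum F[ n ,_] j
      F₁ = F[ suc n , j ]
      F₀ = F[ n , j ]

    -- At j = n + 1 the sum on the right exceeds S(n) by F(n,n) = 1, which contributes (n+2)³. Since
    -- F(n+1,0) = F(n+1,n+1) = 1, the difference h(n+1) - h(0) is 2(n+1)³.
    S-rec : α * S (suc n) ≡ β * S n + fromℕ (cubic n)
    S-rec = begin
      α * S (suc n)
        ≡⟨ solve 2 (λ s h → s := s :+ h :- h) refl (α * S (suc n)) (h 0) ⟩
      α * S (suc n) + h 0 - h 0
        ≡⟨ cong (_- h 0) (telescope (suc n) ℕP.≤-refl) ⟩
      β * (S n + F[ n , n ]) + h (suc n) - h 0
        ≡⟨ cong₂ (λ s t → β * (S n + s) + r (suc n) * (N * N * t) - h 0) (F≡1 n n (nCn≡1 n)) (F≡1 (suc n) (suc n) (nCn≡1 (suc n))) ⟩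
      β * (S n + 1#) + r (suc n) * (N * N * 1#) - h 0
        ≡⟨ cong (λ t → β * (S n + 1#) + r (suc n) * (N * N * 1#) - r 0 * (N * N * t)) (F≡1 (suc n) 0 (nC0≡1 (suc n))) ⟩
      β * (S n + 1#) + r (suc n) * (N * N * 1#) - r 0 * (N * N * 1#)
        ≡⟨ solve 4 (λ β S N M → β :* (S :+ con 1ℤ) :+ (con (+ 2) :* N :- con (+ 3) :* M) :* (N :* N :* con 1ℤ)
                                 :- (con (+ 2) :* con 0ℤ :- con (+ 3) :* M) :* (N :* N :* con 1ℤ)
                       := β :* S :+ (β :+ con (+ 2) :* (N :* (N :* (N :* con 1ℤ))))) refl β (S n) N M ⟩
      β * S n + (β + ⟦ + 2 ⟧ * N ^ 3)
        ≡⟨ cong (λ t → β * S n + t) (sym (fromℕ-cubic n)) ⟩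
      β * S n + fromℕ (cubic n) ∎

  -- Sequences of order O(1/(m + 1)).

  Vanishing : (ℕ → F) → Set
  Vanishing a = ∃[ B ] 0# ≤ B × (∀ m → ∣ a m ∣ * fromℕ (suc m) ≤ B)

  vanishing-cong : ∀ {a b} → (∀ m → a m ≡ b m) → Vanishing a → Vanishing b
  vanishing-cong eq (B , 0≤B , h) = B , 0≤B , λ m → subst (λ t → ∣ t ∣ * fromℕ (suc m) ≤ B) (eq m) (h m)

  vanishing-+ : ∀ {a b} → Vanishing a → Vanishing b → Vanishing (λ m → a m + b m)
  vanishing-+ {a} {b} (A , 0≤A , hA) (B , 0≤B , hB) = A + B , +-nonNeg 0≤A 0≤B , λ m →
    ≤-trans (*-monoʳ (fromℕ-nonNeg (suc m)) (∣p+q∣≤∣p∣+∣q∣ (a m) (b m)))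
      (≤-trans (≤-reflexive (distribʳ (fromℕ (suc m)) ∣ a m ∣ ∣ b m ∣)) (+-mono-≤ (hA m) (hB m)))

  vanishing-*ˡ : ∀ c {a} → Vanishing a → Vanishing (λ m → c * a m)
  vanishing-*ˡ c {a} (A , 0≤A , hA) = ∣ c ∣ * A , *-nonNeg (0≤∣p∣ c) 0≤A , λ m →
    ≤-trans (≤-reflexive (trans (cong (_* fromℕ (suc m)) (∣p*q∣≡∣p∣*∣q∣ c (a m))) (*-assoc ∣ c ∣ ∣ a m ∣ _)))
      (*-monoˡ (0≤∣p∣ c) (hA m))

  vanishing-* : ∀ {a b} → Vanishing a → Vanishing b → Vanishing (λ m → a m * b m)
  vanishing-* {a} {b} (A , 0≤A , hA) (B , 0≤B , hB) = A * B , *-nonNeg 0≤A 0≤B , λ m →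
    ≤-trans (≤-reflexive (trans (cong (_* fromℕ (suc m)) (∣p*q∣≡∣p∣*∣q∣ (a m) (b m))) (*-assoc ∣ a m ∣ ∣ b m ∣ _)))
      (*-mono (*-nonNeg (0≤∣p∣ (b m)) (fromℕ-nonNeg (suc m))) 0≤A
        -- As 1 ≤ m + 1, the rate bound for the first factor also bounds its absolute value by A.
        (≤-trans (≤-trans (≤-reflexive (sym (*-identityʳ ∣ a m ∣))) (*-monoˡ (0≤∣p∣ (a m)) (fromℕ-mono (s≤s z≤n)))) (hA m))
        (hB m))

  vanishing⇒small : ∀ {a} → Vanishing a → ∀ {ε} → 0# < ε → ∃[ N ] ∀ {n} → N ℕ.≤ n → ∣ a n ∣ < ε
  vanishing⇒small {a} (B , 0≤B , h) {ε} 0<ε = K , λ {n} K≤n → *-cancelʳ-< (fromℕ-nonNeg (suc n))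
    (≤-<-trans (h n) (<-≤-trans B<εK (*-monoˡ (<⇒≤ 0<ε) (fromℕ-mono (s≤s K≤n)))))
    where
    0<1+B = +-pos 0<1 0≤B
    -- The divisor 1 + B stays positive even for B = 0, and its excess over B makes the final
    -- inequality strict.
    K,h = archimedean (*-pos 0<ε (⁻¹-pos 0<1+B))
    K = proj₁ K,h
    B<εK : B < ε * fromℕ (suc K)
    B<εK = <-≤-trans (<-respˡ-≡ (+-identityˡ B) (+-monoˡ-< B 0<1))
      (subst₂ _≤_ (*-identityʳ (1# + B))
        (trans (solve 4 (λ s e i t → s :* (e :* i :* t) := e :* t :* (s :* i)) refl (1# + B) ε ((1# + B) ⁻¹) (fromℕ (suc K)))
          (trans (cong (ε * fromℕ (suc K) *_) (⁻¹-inv⁺ 0<1+B)) (*-identityʳ _)))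
        (*-monoˡ (<⇒≤ 0<1+B) (proj₂ K,h)))

  -- Rational approximations of the right-hand side.

  euler-pos : ∀ {x} → 0# < x → ∀ p q m → 0# < euler x p q m
  euler-pos 0<x p q m = *-pos
    (*-pos (fromℕ-pos′ (k !) {{k ℕP.!≢0}}) (⁻¹-pos (rising-pos k 0<x)))
    (*-pos (^-pos p (fromℕ-pos m)) (⁻¹-pos (^-pos q (fromℕ-pos m))))
    where k = suc m ℕ.^ q

  -- The equation on c makes it the abstract counterpart of 3/2.
  module Approximation (c : F) (c+c≡3 : c + c ≡ ⟦ + 3 ⟧) where

    y : ℕ → F
    y n = fromℕ n + c + 1#

    -- The numerator of y = (2n + 5)/2. In this form `num (suc n)` reduces to `2 + num n`, the
    -- numerator that the shift y ↦ y + 1 produces for denominator 2.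
    num : ℕ → ℕ
    num n = 5 ℕ.+ n ℕ.* 2

    -- `g n m` is the m-th Euler approximation of Γ(n + 5/2) = (n + 3/2)!.
    g : ℕ → ℕ → F
    g n = euler (y n) (num n) 2

    t : ℕ → ℕ → F
    t m j = (fromℕ (cubic j) * ⟦ + 4 ⟧ ^ j * g j m) * (fromℕ (1 ℕ.+ j) ^ 2 * fromℕ ((1 ℕ.+ j) !) * fromℕ (2 ℕ.+ j) ^ 3) ⁻¹

    R : ℕ → ℕ → F
    R n m = (fromℕ ((1 ℕ.+ n) !) * fromℕ (1 ℕ.+ n) ^ 2) * (g n m * ⟦ + 4 ⟧ ^ n) ⁻¹ * sum (t m) n

    0<c : 0# < c
    0<c = ≰⇒> λ c≤0 → <-irrefl refl (<-≤-trans (fromℕ-pos 2)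
      (subst₂ _≤_ c+c≡3 (+-identityˡ 0#) (+-mono-≤ c≤0 c≤0)))

    0<y : ∀ n → 0# < y n
    0<y n = +-pos (<-respʳ-≡ (solve 2 (λ c f → c :+ f := f :+ c) refl c (fromℕ n)) (+-pos 0<c (fromℕ-nonNeg n))) (<⇒≤ 0<1)

    y-suc : ∀ n → y (suc n) ≡ y n + 1#
    y-suc n = trans (cong (λ t → t + c + 1#) (fromℕ-suc n))
      (solve 2 (λ f c → con 1ℤ :+ f :+ c :+ con 1ℤ := f :+ c :+ con 1ℤ :+ con 1ℤ) refl (fromℕ n) c)

    y*2 : ∀ n → y n * ⟦ + 2 ⟧ ≡ ⟦ + 5 ⟧ + fromℕ n * ⟦ + 2 ⟧
    y*2 n = begin
      y n * ⟦ + 2 ⟧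
        ≡⟨ solve 2 (λ f c → (f :+ c :+ con 1ℤ) :* con (+ 2) := con (+ 2) :+ (c :+ c) :+ f :* con (+ 2)) refl (fromℕ n) c ⟩
      ⟦ + 2 ⟧ + (c + c) + fromℕ n * ⟦ + 2 ⟧
        ≡⟨ cong (λ t → ⟦ + 2 ⟧ + t + fromℕ n * ⟦ + 2 ⟧) c+c≡3 ⟩
      ⟦ + 2 ⟧ + ⟦ + 3 ⟧ + fromℕ n * ⟦ + 2 ⟧
        ≡⟨ cong (_+ fromℕ n * ⟦ + 2 ⟧) (sym (fromℕ-+ 2 3)) ⟩
      ⟦ + 5 ⟧ + fromℕ n * ⟦ + 2 ⟧ ∎

    y*2≡num : ∀ n → y n * fromℕ 2 ≡ fromℕ (num n)
    y*2≡num n = trans (y*2 n) (sym (trans (fromℕ-+ 5 (n ℕ.* 2)) (cong (λ t → ⟦ + 5 ⟧ + t) (fromℕ-* n 2))))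

    module Step (n : ℕ) where
      open Recurrence n
      module Sh = Shift (y n) (0<y n) (num n) 2
      open Sh using (u; κ; i; 0<κ; 0<i; 0<y+κ)

      P : F
      P = fromℕ (cubic n)

      g-suc : ∀ m → g (suc n) m ≡ g n m * u m
      g-suc m = trans (cong (λ x → euler x (2 ℕ.+ num n) 2 m) (y-suc n)) (sym (Sh.euler-shift m))

      4y≡ : ⟦ + 4 ⟧ * y n ≡ ⟦ + 4 ⟧ * f + ⟦ + 10 ⟧
      4y≡ = begin
        ⟦ + 4 ⟧ * y n
          ≡⟨ solve 1 (λ y → con (+ 4) :* y := con (+ 2) :* (y :* con (+ 2))) refl (y n) ⟩
        ⟦ + 2 ⟧ * (y n * ⟦ + 2 ⟧)
          ≡⟨ cong (⟦ + 2 ⟧ *_) (y*2 n) ⟩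
        ⟦ + 2 ⟧ * (⟦ + 5 ⟧ + f * ⟦ + 2 ⟧)
          ≡⟨ solve 1 (λ f → con (+ 2) :* (con (+ 5) :+ f :* con (+ 2)) := con (+ 4) :* f :+ con (+ 10)) refl f ⟩
        ⟦ + 4 ⟧ * f + ⟦ + 10 ⟧ ∎

      -- Chosen so that `γ * y n` is the coefficient `α` of `S-rec`; replacing y by u gives the
      -- coefficient in `R-rec`.
      γ : F
      γ = ⟦ + 4 ⟧ * (N * N)

      0<N : 0# < N
      0<N = fromℕ-pos n

      0<γ : 0# < γ
      0<γ = *-pos (fromℕ-pos 3) (*-pos 0<N 0<N)

      0<u : ∀ m → 0# < u m
      0<u m = *-pos (0<y n) (*-pos (0<κ m) (0<i m))

      -- From n to n + 1 the prefactor of the sum is multiplied by β/(γu). After multiplication by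
      -- γu, the new prefactor turns the added summand j = n into exactly P.
      R-rec : ∀ m → γ * u m * R (suc n) m ≡ β * R n m + P
      R-rec m = begin
        γ * U * (fromℕ ((2 ℕ.+ n) !) * M ^ 2 * (g (suc n) m * (⟦ + 4 ⟧ * Q)) ⁻¹ * (Σ + P * Q * G * J))
          ≡⟨ cong₂ (λ a b → γ * U * (a * M ^ 2 * (b * (⟦ + 4 ⟧ * Q)) ⁻¹ * (Σ + P * Q * G * J))) (fromℕ-* (2 ℕ.+ n) ((1 ℕ.+ n) !)) (g-suc m) ⟩
        γ * U * (M * A * M ^ 2 * K * (Σ + P * Q * G * J))
          ≡⟨ solve 10 (λ N U M A K Σ P Q G J →
               con (+ 4) :* (N :* N) :* U :* (M :* A :* (M :* (M :* con 1ℤ)) :* K :* (Σ :+ P :* Q :* G :* J))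
               := M :* (M :* (M :* con 1ℤ)) :* (A :* (N :* (N :* con 1ℤ)) :* (con (+ 4) :* U :* K) :* Σ)
                  :+ P :* ((N :* (N :* con 1ℤ)) :* A :* (M :* (M :* (M :* con 1ℤ))) :* J) :* (G :* Q :* (con (+ 4) :* U :* K)))
               refl N U M A K Σ P Q G J ⟩
        β * (A * N ^ 2 * (⟦ + 4 ⟧ * U * K) * Σ) + P * (N ^ 2 * A * M ^ 3 * J) * (G * Q * (⟦ + 4 ⟧ * U * K))
          ≡⟨ cong₂ (λ s t → β * (A * N ^ 2 * s * Σ) + P * (N ^ 2 * A * M ^ 3 * J) * t) (sym I≡) GQ4UK≡1 ⟩
        β * R n m + P * (N ^ 2 * A * M ^ 3 * J) * 1#
          ≡⟨ cong (λ t → β * R n m + P * t * 1#) (⁻¹-inv⁺ (*-pos (*-pos (^-pos 2 0<N) 0<A) (^-pos 3 (fromℕ-pos (suc n))))) ⟩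
        β * R n m + P * 1# * 1#
          ≡⟨ cong (λ t → β * R n m + t) (trans (*-identityʳ _) (*-identityʳ P)) ⟩
        β * R n m + P ∎
        where
        U = u m
        G = g n m
        Q = ⟦ + 4 ⟧ ^ n
        A = fromℕ ((1 ℕ.+ n) !)
        Σ = sum (t m) n
        J = (N ^ 2 * A * M ^ 3) ⁻¹
        K = (G * U * (⟦ + 4 ⟧ * Q)) ⁻¹
        0<A : 0# < A
        0<A = fromℕ-pos′ ((1 ℕ.+ n) !) {{(1 ℕ.+ n) ℕP.!≢0}}
        0<G : 0# < G
        0<G = euler-pos (0<y n) (num n) 2 m
        0<Q : 0# < Q
        0<Q = ^-pos n (fromℕ-pos 3)
        GQ4UK≡1 : G * Q * (⟦ + 4 ⟧ * U * K) ≡ 1#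
        GQ4UK≡1 = trans
          (solve 4 (λ G Q U K → G :* Q :* (con (+ 4) :* U :* K) := G :* U :* (con (+ 4) :* Q) :* K) refl G Q U K)
          (⁻¹-inv⁺ (*-pos (*-pos 0<G (0<u m)) (*-pos (fromℕ-pos 3) 0<Q)))
        I≡ : (G * Q) ⁻¹ ≡ ⟦ + 4 ⟧ * U * K
        I≡ = ⁻¹-unique (*-pos 0<G 0<Q) GQ4UK≡1

      -- Recurrence for the approximation error.

      e e′ : ℕ → F
      e m = S n - R n m
      e′ m = S (suc n) - R (suc n) m

      ν : ℕ → F
      ν m = κ m ⁻¹

      Y = y n ⁻¹
      Γ⁻ = γ ⁻¹

      -- Here u = yκ/(y + κ) with κ = (m + 1)², so its reciprocal splits into 1/y + 1/κ.
      u-inv : ∀ m → u m * (Y + ν m) ≡ 1#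
      u-inv m = begin
        y n * (κ m * i m) * (Y + ν m)
          ≡⟨ solve 5 (λ y κ i Y ν → y :* (κ :* i) :* (Y :+ ν) := κ :* i :* (y :* Y) :+ y :* i :* (κ :* ν)) refl (y n) (κ m) (i m) Y (ν m) ⟩
        κ m * i m * (y n * Y) + y n * i m * (κ m * ν m)
          ≡⟨ cong₂ (λ s t → κ m * i m * s + y n * i m * t) (⁻¹-inv⁺ (0<y n)) (⁻¹-inv⁺ (0<κ m)) ⟩
        κ m * i m * 1# + y n * i m * 1#
          ≡⟨ solve 3 (λ y κ i → κ :* i :* con 1ℤ :+ y :* i :* con 1ℤ := (y :+ κ) :* i) refl (y n) (κ m) (i m) ⟩
        (y n + κ m) * i m
          ≡⟨ ⁻¹-inv⁺ (0<y+κ m) ⟩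
        1# ∎

      -- Subtract the two recurrences, solved for their leading terms, and substitute 1/u = Y + ν.
      -- Writing R = S - e then leaves coefficients independent of m on e, νe and ν, so each term
      -- inherits the rate O(1/m).
      e-rec : ∀ m → (Γ⁻ * Y * β) * e m + ((Γ⁻ * β) * (ν m * e m) + (- (Γ⁻ * (β * S n + P))) * ν m) ≡ e′ m
      e-rec m = *-cancelˡ-≡ (*-pos 0<γ (0<u m)) (begin
        γ * U * ((Γ⁻ * Y * β) * (s - ρ) + ((Γ⁻ * β) * (ν m * (s - ρ)) + (- (Γ⁻ * (β * s + P))) * ν m))
          ≡⟨ solve 9 (λ γ Γ⁻ U Y β s ρ P ν →
               γ :* U :* ((Γ⁻ :* Y :* β) :* (s :- ρ) :+ ((Γ⁻ :* β) :* (ν :* (s :- ρ)) :+ (:- (Γ⁻ :* (β :* s :+ P))) :* ν))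
               := (γ :* Γ⁻) :* (U :* Y :* (β :* s :+ P) :- U :* (Y :+ ν) :* (β :* ρ :+ P)))
               refl γ Γ⁻ U Y β s ρ P (ν m) ⟩
        (γ * Γ⁻) * (U * Y * (β * s + P) - U * (Y + ν m) * (β * ρ + P))
          ≡⟨ cong₂ (λ a b → a * (U * Y * (β * s + P) - b * (β * ρ + P))) (⁻¹-inv⁺ 0<γ) (u-inv m) ⟩
        1# * (U * Y * (β * s + P) - 1# * (β * ρ + P))
          ≡⟨ cong₂ (λ a b → 1# * (U * Y * a - 1# * b)) (sym S-rec′) (sym (R-rec m)) ⟩
        1# * (U * Y * (γ * y n * s′) - 1# * (γ * U * ρ′))
          ≡⟨ solve 6 (λ U Y γ y s′ ρ′ → con 1ℤ :* (U :* Y :* (γ :* y :* s′) :- con 1ℤ :* (γ :* U :* ρ′))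
                        := γ :* U :* ((y :* Y) :* s′ :- ρ′)) refl U Y γ (y n) s′ ρ′ ⟩
        γ * U * ((y n * Y) * s′ - ρ′)
          ≡⟨ cong (λ a → γ * U * (a * s′ - ρ′)) (⁻¹-inv⁺ (0<y n)) ⟩
        γ * U * (1# * s′ - ρ′)
          ≡⟨ cong (λ a → γ * U * (a - ρ′)) (*-identityˡ s′) ⟩
        γ * U * e′ m ∎)
        where
        U = u m
        s = S n
        ρ = R n m
        s′ = S (suc n)
        ρ′ = R (suc n) m
        S-rec′ : γ * y n * s′ ≡ β * s + P
        S-rec′ = trans (cong (_* s′) (trans
          (solve 2 (λ N y → con (+ 4) :* (N :* N) :* y := con (+ 4) :* y :* (N :* N)) refl N (y n))
          (cong (_* (N * N)) 4y≡))) S-rec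

      ν-vanishing : Vanishing ν
      ν-vanishing = 1# , <⇒≤ 0<1 , λ m →
        let 0<ν = ⁻¹-pos (0<κ m) in
        subst₂ _≤_ (cong (_* fromℕ (suc m)) (sym (0≤p⇒∣p∣≡p (<⇒≤ 0<ν)))) (trans (*-comm (ν m) _) (⁻¹-inv⁺ (0<κ m)))
          (*-monoˡ (<⇒≤ 0<ν) (fromℕ-mono (suc≤square m)))
        where
        suc≤square : ∀ m → suc m ℕ.≤ suc m ℕ.^ 2
        suc≤square m = ℕP.m≤m*n (suc m) (suc m ℕ.^ 1) {{ℕP.m^n≢0 (suc m) 1}}

      step : Vanishing e → Vanishing e′
      step v = vanishing-cong e-rec (vanishing-+ (vanishing-*ˡ (Γ⁻ * Y * β) v)
        (vanishing-+ (vanishing-*ˡ (Γ⁻ * β) (vanishing-* ν-vanishing v)) (vanishing-*ˡ (- (Γ⁻ * (β * S n + P))) ν-vanishing)))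

    error-vanishing : ∀ n → Vanishing (λ m → S n - R n m)
    -- For n = 0 both sums are empty and the error is exactly zero.
    error-vanishing zero    = 0# , ≤-refl , λ m → ≤-reflexive (begin
      ∣ 0# - R 0 m ∣ * fromℕ (suc m)  ≡⟨ cong (λ t → ∣ 0# - t ∣ * fromℕ (suc m)) (zeroʳ _) ⟩
      ∣ 0# - 0# ∣ * fromℕ (suc m)     ≡⟨ cong (λ t → ∣ t ∣ * fromℕ (suc m)) (solve 0 (con 0ℤ :- con 0ℤ := con 0ℤ) refl) ⟩
      ∣ 0# ∣ * fromℕ (suc m)          ≡⟨ cong (_* fromℕ (suc m)) (0≤p⇒∣p∣≡p ≤-refl) ⟩
      0# * fromℕ (suc m)              ≡⟨ solve 1 (λ f → con 0ℤ :* f := con 0ℤ) refl (fromℕ (suc m)) ⟩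
      0# ∎)
    error-vanishing (suc n) = Step.step n (error-vanishing n)

-- Transfer to the Cauchy reals.

open import Defs
open import Data.Fin.Base as Fin using (Fin; toℕ)
open import Data.Nat.Base using (NonZero; _+_; _*_; _^_)
open import Data.Nat.Coprimality using (Coprime; coprime?; coprime-+)
import Data.Rational.Base as ℚ
import Data.Rational.Properties as ℚP
open import Relation.Nullary.Decidable using (from-yes)

module Id = Identity ℚ-orderedField
module Ap = Id.Approximation (+ 3 ℚ./ 2) refl

approx-∑ : ∀ n (f : Fin n → ℝ) (a : ℕ → ℚ.ℚ) m → (∀ i → approx (f i) m ≡ a (toℕ i)) → approx (∑ n f) m ≡ Id.sum a n
approx-∑ zero    f a m eq = refl
approx-∑ (suc n) f a m eq =
  trans (cong₂ ℚ._+_ (eq Fin.zero) (approx-∑ n (f ∘ Fin.suc) (a ∘ suc) m (eq ∘ Fin.suc))) (sym (Id.sum-head a n))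

-- `Γ` reads its exponents off the reduced fraction, so 2n + 5 over 2 must be in lowest terms;
-- adding 2 preserves coprimality with 2.
num-coprime : ∀ n → Coprime (Ap.num n) 2
num-coprime zero    = from-yes (coprime? 5 2)
num-coprime (suc n) = coprime-+ (num-coprime n)

-- Exhibits the normal form of n + 5/2, from which numerator and denominator can be read; both sides
-- agree after doubling.
y≡num/2 : ∀ n → Ap.y n ≡ ℚ.mkℚ (+ Ap.num n) 1 (num-coprime n)
y≡num/2 n = Id.*-cancelˡ-≡ {fromℕ 2} (Conv.fromℕ-pos 1)
  (trans (ℚP.*-comm (fromℕ 2) (Ap.y n)) (trans (Ap.y*2≡num n)
    (trans (sym (↥≡*↧ {x} (ℚP.positive⁻¹ x))) (ℚP.*-comm x (fromℕ 2)))))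
  where x = ℚ.mkℚ (+ Ap.num n) 1 (num-coprime n)

approx-[+3/2]! : ∀ n m → approx [ n +3/2]! m ≡ Ap.g n m
approx-[+3/2]! n m = trans
  (cong₂ (λ p q → euler (Ap.y n) p q m) (cong (ℤ.∣_∣ ∘ ℚ.↥_) (y≡num/2 n)) (cong ℚ.↧ₙ_ (y≡num/2 n)))
  (sym (euler≡ (Ap.y n) (Ap.num n) 2 m))

-- The left-hand side involves only rational constants, so its approximations do not depend on m.
lhs≡S : ∀ n m → approx (∑[ k < n ] (ℕ→ℝ 1 ÷ℝ (n choose k) ^ℝ 2)) m ≡ Id.S n
lhs≡S n m = approx-∑ n _ Id.F[ n ,_] m λ k →
  trans (ℚP.*-identityˡ _) (cong _⁻¹ (sym (^≡ (fromℕ (n C toℕ k)) 2)))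

rhs-term : ℕ → ℝ
rhs-term j =
  (ℕ→ℝ (cubic j) *ℝ ℕ→ℝ 4 ^ℝ j *ℝ [ j +3/2]!)
  ÷ℝ
  (ℕ→ℝ (1 + j) ^ℝ 2 *ℝ (1 + j) !ℝ *ℝ ℕ→ℝ (2 + j) ^ℝ 3)

rhs : ℕ → ℝ
rhs n =
  (((1 + n) !ℝ *ℝ ℕ→ℝ (1 + n) ^ℝ 2) ÷ℝ ([ n +3/2]! *ℝ ℕ→ℝ 4 ^ℝ n))
  *ℝ
  ∑[ i < n ] rhs-term (toℕ i)

approx-rhs-term : ∀ j m → approx (rhs-term j) m ≡ Ap.t m j
approx-rhs-term j m = cong₂ (λ a b → a ℚ.* b ⁻¹)
  (cong₂ (λ a b → fromℕ (cubic j) ℚ.* a ℚ.* b) (sym (^≡ (fromℕ 4) j)) (approx-[+3/2]! j m))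
  (cong₂ (λ a b → a ℚ.* fromℕ ((1 + j) !) ℚ.* b) (sym (^≡ (fromℕ (1 + j)) 2)) (sym (^≡ (fromℕ (2 + j)) 3)))

rhs≡R : ∀ n m → approx (rhs n) m ≡ Ap.R n m
rhs≡R n m = cong₂ ℚ._*_
  (cong₂ (λ a b → fromℕ ((1 + n) !) ℚ.* a ℚ.* b ⁻¹) (sym (^≡ (fromℕ (1 + n)) 2))
    (cong₂ ℚ._*_ (approx-[+3/2]! n m) (sym (^≡ (fromℕ 4) n))))
  (approx-∑ n (rhs-term ∘ toℕ) (Ap.t m) m (λ i → approx-rhs-term (toℕ i) m))

theorem1 : (n : ℕ) → .{{_ : NonZero n}} →
    ∑[ k < n ] (ℕ→ℝ 1 ÷ℝ (n choose k) ^ℝ 2)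
    ≈ℝ
    (((1 + n) !ℝ *ℝ ℕ→ℝ (1 + n) ^ℝ 2) ÷ℝ ([ n +3/2]! *ℝ ℕ→ℝ 4 ^ℝ n))
    *ℝ
    ∑[ i < n ] (let j = toℕ i in
    (ℕ→ℝ (3 * j ^ 3 + 12 * j ^ 2 + 18 * j + 10) *ℝ ℕ→ℝ 4 ^ℝ j *ℝ [ j +3/2]!)
    ÷ℝ
    (ℕ→ℝ (1 + j) ^ℝ 2 *ℝ (1 + j) !ℝ *ℝ ℕ→ℝ (2 + j) ^ℝ 3))
-- The difference of the m-th approximations is the error S(n) - R(n,m), whose rate yields the
-- required N for each ε.
theorem1 n = Id.vanishing⇒small (Id.vanishing-cong
  (λ m → sym (cong₂ ℚ._-_ (lhs≡S n m) (rhs≡R n m))) (Ap.error-vanishing n))
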